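{- Let $k\ge2$, $n\ge1$ and let $p_1,\ldots,p_k$ be positive integers. The mapping $\Psi$ is a bijection between labelled rooted $k$-nebulas of size $n$ and type $(p_1,\ldots,p_k)$ and valid biddings of size $n$ and type $(p_1,\ldots,p_k)$.
   Context: $[m]=\{1,\ldots,m\}$; types are taken modulo $k$. A map is a cellular embedding (all faces simply connected) of a connected graph in an oriented compact connected surface without boundary, up to orientation preserving homeomorphism. A bud is a dangling half-edge (not part of a complete edge). A $k$-nebula is a map having a single face, with black and white vertices, edges of types $1,\ldots,k$ and buds of types $1,\ldots,k$, such that (i) each edge joins a black and a white vertex; (ii) each black vertex has degree $k$ (counting buds); (iii) in clockwise order around a black vertex (resp. white vertex) the type of the edges or buds increases (resp. decreases) by one modulo $k$ from one half-edge to the next; (iv) for all $t\in[k]$ the number of buds of type $t$ incident to black vertices (black buds) equals the number of buds of type $t$ incident to white vertices (white buds). It is rooted if one black vertex is distinguished (root vertex). It has size $n$ and type $(p_1,\ldots,p_k)$ if it has $n$ black vertices and $p_t$ black buds of type $t$ for all $t$. It is labelled if its black vertices are given distinct labels in $[n]$ and, for each $t$, its $p_t$ white buds of type $t$ are given distinct labels in $L_t$, where $L_t$ is the set of labels of the $p_t$ black vertices incident to black buds of type $t$. The label of an edge is the label of its black endpoint; hence for every $(t,i)\in[k]\times[n]$ there is exactly one object which is either an edge or a white bud of type $t$ and label $i$. Let $c(t,i)$ be the corner preceding this edge or white bud in clockwise order around its incident white vertex. Turning clockwise around a nebula $N$ means walking around its unique face following its edges, with the edges on the right side of the walker (buds are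 just crossed). For a labelled rooted nebula $N$, this visits each white corner $c(t,i)$ once and so defines a cyclic order on $[k]\times[n]$; the appearance order $\prec_N$ is the total order on $[k]\times[n]$ obtained by declaring $(k,\ell_0)$ to be the greatest element, where $\ell_0$ is the label of the root vertex. Then $\Psi(N)=((\omega_1,\ldots,\omega_k),(R_1,\ldots,R_n))$ where $R_i\subsetneq[k]$ is the set of types of the buds incident to the black vertex labelled $i$, and $\omega_t$ is the permutation of $[n]$ such that $(t,\omega_t(1))\prec_N(t,\omega_t(2))\prec_N\cdots\prec_N(t,\omega_t(n))$. A bidding of size $n$ and type $(p_1,\ldots,p_k)$ is a pair $((\omega_1,\ldots,\omega_k),(R_1,\ldots,R_n))$ where $\omega_1,\ldots,\omega_k$ are permutations of $[n]$ and $R_1,\ldots,R_n$ are strict subsets of $[k]$ such that each $t\in[k]$ belongs to exactly $p_t$ of them. For $t\in[k]$, $R\subsetneq[k]$, let $\alpha(t,R)\in[k]$ be (modulo $k$): $t-1$ if $t\in R$; $t+r$ if $t\notin R$, where $r\ge 0$ is such that $t+1,\ldots,t+r\in R$ and $t+r+1\notin R$. The bidding is valid if the undirected graph with vertex set $[k]$ and with the $k-1$ edges $\{t,\alpha(t,R_{\omega_t(n)})\}$, $t=1,\ldots,k-1$ (loops and multiple edges allowed), is a tree. -}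

module Defs where

open import Data.Fin.Base using (Fin; toℕ; fromℕ; inject≤; _<_)
open import Data.Fin.Permutation as Perm
  using (Permutation; Permutation′; _⟨$⟩ʳ_; _⟨$⟩ˡ_; inverseˡ; inverseʳ)
open import Data.Fin.Properties using (_≟_; toℕ-injective; toℕ-fromℕ<; toℕ<n)
open import Data.Fin.Subset using (Subset; ⊤; _∈_; _∉_; _⊂_)
open import Data.Fin.Subset.Properties using (_∈?_)
open import Data.List.Base using (List; []; _∷_; length; filter; allFin)
open import Data.List.Relation.Unary.Unique.Propositional using (Unique)
open import Data.Nat.Base as ℕ using (ℕ; zero; suc; _+_; _∸_; NonZero; z≤n; s≤s)
open import Data.Nat.DivMod
  using (_mod_; _%_; m%n<n; m<n⇒m%n≡m; [m+n]%n≡m%n; %-distribˡ-+)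
open import Data.Nat.GeneralisedArithmetic using (fold)
import Data.Nat.Properties as ℕ
open import Data.Product.Base using (Σ; ∃; ∃₂; _×_; _,_; proj₁; proj₂)
open import Data.Sum.Base using (_⊎_)
open import Function.Bundles using (_⇔_)
open import Level using (0ℓ)
open import Relation.Binary.Bundles using (Setoid)
import Relation.Binary.Construct.On as On
open import Relation.Binary.Construct.Closure.ReflexiveTransitive using (Star)
open import Relation.Binary.Definitions using (DecidableEquality)
open import Relation.Binary.PropositionalEquality.Core
  using (_≡_; _≢_; refl; sym; trans; cong; subst)
open import Relation.Nullary.Decidable using (yes; no; _×-dec_)
open import Relation.Nullary.Negation using (¬_; contradiction)
open import Relation.Unary using (Pred; Decidable)

count : ∀ {m} {P : Pred (Fin m) 0ℓ} → Decidable P → ℕ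
count {m} P? = length (filter P? (allFin m))

-- The set [m] = {1,…,m} is `Fin m`: the element j of [m] is the one
-- whose `toℕ` is j ∸ 1.  In particular m itself is `largest m`.

largest : ∀ m → .{{_ : NonZero m}} → Fin m
largest (suc m) = fromℕ m

-- t + 1 and t - 1 modulo k.

next prev : ∀ {k} → Fin k → Fin k
next {suc k} t = suc (toℕ t) mod suc k
prev {suc k} t = (toℕ t + k) mod suc k

-- A cellular embedding of a connected graph in an oriented closed surface,
-- taken up to orientation preserving homeomorphism, is encoded by its
-- rotation system: an edge is a pair of half-edges exchanged by `mate`, a
-- bud is a half-edge fixed by `mate`, and `rot` sends a half-edge to the
-- next one in clockwise order around its vertex.

record Map : Set where
  field
    #V #H : ℕ

  V : Set
  V = Fin #V

  H : Set
  H = Fin #H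

  field
    vertex    : H → V
    rotation  : Permutation′ #H
    mate      : H → H

  rot : H → H
  rot = rotation ⟨$⟩ʳ_

  Adjacent : V → V → Set
  Adjacent u v = ∃ λ h → vertex h ≡ u × vertex (mate h) ≡ v

  field
    rot-cyclic      : ∀ g h → (vertex g ≡ vertex h) ⇔ (∃ λ m → fold g rot m ≡ h)
    mate-involutive : ∀ h → mate (mate h) ≡ h
    connected       : ∀ u v → Star Adjacent u v

  Bud : H → Set
  Bud h = mate h ≡ h

  -- A half-edge h also stands for the corner which precedes it in clockwise
  -- order around its vertex.  A walker in this corner who follows h with h
  -- on their right (or crosses h, if it is a bud) next reaches the corner
  -- `turn h`.  The faces are the cycles of `turn`.  (A map without
  -- half-edges is a single vertex on the sphere, which has one face.)

  turn : H → H
  turn h = rot (mate h)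

  SingleFace : Set
  SingleFace = ∀ g h → ∃ λ m → fold g turn m ≡ h

data Colour : Set where
  black white : Colour

_≟ᶜ_ : DecidableEquality Colour
black ≟ᶜ black = yes refl
black ≟ᶜ white = no λ ()
white ≟ᶜ black = no λ ()
white ≟ᶜ white = yes refl

record Nebula (k : ℕ) : Set where
  field
    map : Map

  open Map map public

  field
    colour : V → Colour
    type   : H → Fin k

  Black : V → Set
  Black v = colour v ≡ black

  White : V → Set
  White v = colour v ≡ white

  BlackBud : H → Set
  BlackBud h = Bud h × Black (vertex h)

  WhiteBud : H → Set
  WhiteBud h = Bud h × White (vertex h)

  #blackVertices : ℕ
  #blackVertices = count (λ v → colour v ≟ᶜ black)

  degree : V → ℕ
  degree v = count (λ h → vertex h ≟ v)

  #buds : Colour → Fin k → ℕ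
  #buds c t =
    count (λ h → ((mate h ≟ h) ×-dec (colour (vertex h) ≟ᶜ c)) ×-dec (type h ≟ t))

  field
    type-mate    : ∀ h → type (mate h) ≡ type h
    single-face  : SingleFace
    bipartite    : ∀ h → ¬ Bud h → colour (vertex (mate h)) ≢ colour (vertex h)
    black-degree : ∀ v → Black v → degree v ≡ k
    black-types  : ∀ h → Black (vertex h) → type (rot h) ≡ next (type h)
    white-types  : ∀ h → White (vertex h) → type (rot h) ≡ prev (type h)
    balanced     : ∀ t → #buds black t ≡ #buds white t

record LabelledRootedNebula (k n : ℕ) (p : Fin k → ℕ) : Set where
  field
    nebula : Nebula k

  open Nebula nebula public

  field
    size       : #blackVertices ≡ n
    bud-type   : ∀ t → #buds black t ≡ p t
    root       : V
    root-black : Black root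
    blackLabel : ∀ v → .(Black v) → Fin n
    budLabel   : ∀ h → .(WhiteBud h) → Fin n
    blackLabel-injective : ∀ u v (b : Black u) (c : Black v) →
      blackLabel u b ≡ blackLabel v c → u ≡ v
    budLabel-injective : ∀ g h (b : WhiteBud g) (c : WhiteBud h) →
      type g ≡ type h → budLabel g b ≡ budLabel h c → g ≡ h
    -- The label of a white bud of type t belongs to L_t.
    budLabel-matched : ∀ h (b : WhiteBud h) → ∃ λ g → Σ (BlackBud g) λ c →
      type g ≡ type h × blackLabel (vertex g) (proj₂ c) ≡ budLabel h b

  -- `Object t i w`: w is the half-edge at a white vertex of the edge of
  -- type t and label i, or is the white bud of type t and label i.

  data Object (t : Fin k) (i : Fin n) (w : H) : Set where
    edge : White (vertex w) → (b : Black (vertex (mate w))) → type w ≡ t →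
           blackLabel (vertex (mate w)) b ≡ i → Object t i w
    bud  : (b : WhiteBud w) → type w ≡ t → budLabel w b ≡ i → Object t i w

  -- A full turn around the unique face consists of #H steps.  Starting from
  -- the corner of (k , label of the root), which is thus reached last, the
  -- m-th corner visited is `fold start turn m` for 1 ≤ m ≤ #H.

  Precedes : .{{_ : NonZero k}} → Fin k × Fin n → Fin k × Fin n → Set
  Precedes (t , i) (u , j) =
    ∃ λ start → Object (largest k) (blackLabel root root-black) start ×
    ∃₂ λ a b → 1 ℕ.≤ a × a ℕ.< b × b ℕ.≤ #H ×
      Object t i (fold start turn a) × Object u j (fold start turn b)

record Isomorphic {k n p} (N N′ : LabelledRootedNebula k n p) : Set where
  private
    module N  = LabelledRootedNebula N
    module N′ = LabelledRootedNebula N′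
  field
    onV : Permutation N.#V N′.#V
    onH : Permutation N.#H N′.#H
    vertex-≅ : ∀ h → N′.vertex (onH ⟨$⟩ʳ h) ≡ onV ⟨$⟩ʳ N.vertex h
    rot-≅    : ∀ h → N′.rot (onH ⟨$⟩ʳ h) ≡ onH ⟨$⟩ʳ N.rot h
    mate-≅   : ∀ h → N′.mate (onH ⟨$⟩ʳ h) ≡ onH ⟨$⟩ʳ N.mate h
    colour-≅ : ∀ v → N′.colour (onV ⟨$⟩ʳ v) ≡ N.colour v
    type-≅   : ∀ h → N′.type (onH ⟨$⟩ʳ h) ≡ N.type h
    root-≅   : N′.root ≡ onV ⟨$⟩ʳ N.root
    blackLabel-≅ : ∀ v (b : N.Black v) (b′ : N′.Black (onV ⟨$⟩ʳ v)) →
      N′.blackLabel (onV ⟨$⟩ʳ v) b′ ≡ N.blackLabel v b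
    budLabel-≅ : ∀ h (b : N.WhiteBud h) (b′ : N′.WhiteBud (onH ⟨$⟩ʳ h)) →
      N′.budLabel (onH ⟨$⟩ʳ h) b′ ≡ N.budLabel h b

module _ {k n : ℕ} {p : Fin k → ℕ} where
  open Isomorphic

  private
    LRN : Set
    LRN = LabelledRootedNebula k n p

  Isomorphic-refl : {N : LRN} → Isomorphic N N
  Isomorphic-refl = record
    { onV = Perm.id ; onH = Perm.id
    ; vertex-≅ = λ _ → refl ; rot-≅ = λ _ → refl ; mate-≅ = λ _ → refl
    ; colour-≅ = λ _ → refl ; type-≅ = λ _ → refl ; root-≅ = refl
    ; blackLabel-≅ = λ _ _ _ → refl ; budLabel-≅ = λ _ _ _ → refl
    }

  Isomorphic-sym : {N N′ : LRN} → Isomorphic N N′ → Isomorphic N′ N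
  Isomorphic-sym {N} {N′} F = record
    { onV = Perm.flip (onV F) ; onH = Perm.flip (onH F)
    ; vertex-≅ = vertexˡ
    ; rot-≅  = λ h → move (onH F) (trans (sym (rot-≅ F _)) (cong N′.rot (Hʳ h)))
    ; mate-≅ = mateˡ
    ; colour-≅ = colourˡ
    ; type-≅ = λ h → trans (sym (type-≅ F _)) (cong N′.type (Hʳ h))
    ; root-≅ = move (onV F) (sym (root-≅ F))
    ; blackLabel-≅ = λ v b b′ →
        let c = subst N′.Black (sym (Vʳ v)) b
        in trans (sym (blackLabel-≅ F _ b′ c)) (blackLabel-cong (Vʳ v) c b)
    ; budLabel-≅ = λ h b b′ →
        let c = subst N′.WhiteBud (sym (Hʳ h)) b
        in trans (sym (budLabel-≅ F _ b′ c)) (budLabel-cong (Hʳ h) c b)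
    }
    where
    module N  = LabelledRootedNebula N
    module N′ = LabelledRootedNebula N′

    Vʳ : ∀ v → onV F ⟨$⟩ʳ (onV F ⟨$⟩ˡ v) ≡ v
    Vʳ _ = inverseʳ (onV F)

    Hʳ : ∀ h → onH F ⟨$⟩ʳ (onH F ⟨$⟩ˡ h) ≡ h
    Hʳ _ = inverseʳ (onH F)

    move : ∀ {a b} (π : Permutation a b) {x y} → π ⟨$⟩ʳ x ≡ y → x ≡ π ⟨$⟩ˡ y
    move π eq = trans (sym (inverseˡ π)) (cong (π ⟨$⟩ˡ_) eq)

    vertexˡ : ∀ h → N.vertex (onH F ⟨$⟩ˡ h) ≡ onV F ⟨$⟩ˡ N′.vertex h
    vertexˡ h = move (onV F) (trans (sym (vertex-≅ F _)) (cong N′.vertex (Hʳ h)))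

    mateˡ : ∀ h → N.mate (onH F ⟨$⟩ˡ h) ≡ onH F ⟨$⟩ˡ N′.mate h
    mateˡ h = move (onH F) (trans (sym (mate-≅ F _)) (cong N′.mate (Hʳ h)))

    colourˡ : ∀ v → N.colour (onV F ⟨$⟩ˡ v) ≡ N′.colour v
    colourˡ v = trans (sym (colour-≅ F _)) (cong N′.colour (Vʳ v))

    blackLabel-cong : ∀ {u v} → u ≡ v → (b : N′.Black u) (c : N′.Black v) →
      N′.blackLabel u b ≡ N′.blackLabel v c
    blackLabel-cong refl _ _ = refl

    budLabel-cong : ∀ {g h} → g ≡ h → (b : N′.WhiteBud g) (c : N′.WhiteBud h) →
      N′.budLabel g b ≡ N′.budLabel h c
    budLabel-cong refl _ _ = refl

  Isomorphic-trans : {N₁ N₂ N₃ : LRN} →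
    Isomorphic N₁ N₂ → Isomorphic N₂ N₃ → Isomorphic N₁ N₃
  Isomorphic-trans {N₁} {N₂} {N₃} F G = record
    { onV = onV F Perm.∘ₚ onV G ; onH = onH F Perm.∘ₚ onH G
    ; vertex-≅ = λ h → trans (vertex-≅ G _) (cong (onV G ⟨$⟩ʳ_) (vertex-≅ F h))
    ; rot-≅    = λ h → trans (rot-≅ G _) (cong (onH G ⟨$⟩ʳ_) (rot-≅ F h))
    ; mate-≅   = λ h → trans (mate-≅ G _) (cong (onH G ⟨$⟩ʳ_) (mate-≅ F h))
    ; colour-≅ = λ v → trans (colour-≅ G _) (colour-≅ F v)
    ; type-≅   = λ h → trans (type-≅ G _) (type-≅ F h)
    ; root-≅   = trans (root-≅ G) (cong (onV G ⟨$⟩ʳ_) (root-≅ F))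
    ; blackLabel-≅ = λ v b b″ →
        let b′ = trans (colour-≅ F v) b
        in trans (blackLabel-≅ G _ b′ b″) (blackLabel-≅ F v b b′)
    ; budLabel-≅ = λ h b b″ →
        let b′ = whiteBud h b
        in trans (budLabel-≅ G _ b′ b″) (budLabel-≅ F h b b′)
    }
    where
    module N₁ = LabelledRootedNebula N₁
    module N₂ = LabelledRootedNebula N₂

    whiteBud : ∀ h → N₁.WhiteBud h → N₂.WhiteBud (onH F ⟨$⟩ʳ h)
    whiteBud h (m , w) =
      trans (mate-≅ F h) (cong (onH F ⟨$⟩ʳ_) m) ,
      trans (cong N₂.colour (vertex-≅ F h)) (trans (colour-≅ F _) w)

LabelledRootedNebulas : (k n : ℕ) → (Fin k → ℕ) → Setoid 0ℓ 0ℓ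
LabelledRootedNebulas k n p = record
  { Carrier = LabelledRootedNebula k n p
  ; _≈_ = Isomorphic
  ; isEquivalence = record
    { refl = Isomorphic-refl ; sym = Isomorphic-sym ; trans = Isomorphic-trans }
  }

-- Loops and multiple edges are allowed.

Multigraph : ℕ → ℕ → Set
Multigraph v e = Fin e → Fin v × Fin v

module _ {v e : ℕ} (G : Multigraph v e) where

  Joins : Fin e → Fin v → Fin v → Set
  Joins a x y = G a ≡ (x , y) ⊎ G a ≡ (y , x)

  -- `Walk x y xs as`: a walk from x to y which traverses the edges as, and
  -- whose successive vertices are those of xs followed by y.

  data Walk : Fin v → Fin v → List (Fin v) → List (Fin e) → Set where
    stop : ∀ {x} → Walk x x [] []
    step : ∀ {x y z a xs as} →
           Joins a x y → Walk y z xs as → Walk x z (x ∷ xs) (a ∷ as)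

  record IsTree : Set where
    field
      connected : ∀ x y → ∃₂ λ xs as → Walk x y xs as
      acyclic   : ∀ {x xs as} → Walk x x xs as → Unique xs → Unique as → as ≡ []

-- `skip m t R` moves from t to t + r, with r ≤ m least possible such that
-- t + r + 1 ∉ R if there is one.  As k steps lead back to t, the bound k
-- used in α is never reached; this is α-∉ below.

skip : ∀ {k} → ℕ → Fin k → Subset k → Fin k
skip zero    t R = t
skip (suc m) t R with next t ∈? R
... | yes _ = skip m (next t) R
... | no  _ = t

α : ∀ {k} → Fin k → Subset k → Fin k
α {k} t R with t ∈? R
... | yes _ = prev t
... | no  _ = skip k t R

record Bidding (k n : ℕ) (p : Fin k → ℕ) : Set where
  field
    ω        : Fin k → Permutation′ n
    R        : Fin n → Subset k
    R-strict : ∀ i → R i ⊂ ⊤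
    R-type   : ∀ t → count (λ i → t ∈? R i) ≡ p t

module _ {k n : ℕ} {p : Fin k → ℕ} .{{_ : NonZero n}} (B : Bidding k n p) where
  open Bidding B

  biddingGraph : Multigraph k (k ∸ 1)
  biddingGraph s = t , α t (R (ω t ⟨$⟩ʳ largest n))
    where
    t : Fin k
    t = inject≤ s (ℕ.m∸n≤m k 1)

  Valid : Set
  Valid = IsTree biddingGraph

Biddings : (k n : ℕ) → (Fin k → ℕ) → Setoid 0ℓ 0ℓ
Biddings k n p = record
  { Carrier = Bidding k n p
  ; _≈_ = λ B B′ → (∀ t → ω B t Perm.≈ ω B′ t) × (∀ i → R B i ≡ R B′ i)
  ; isEquivalence = record
    { refl  = (λ _ _ → refl) , (λ _ → refl)
    ; sym   = λ (f , g) → (λ t i → sym (f t i)) , (λ i → sym (g i))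
    ; trans = λ (f , g) (f′ , g′) →
        (λ t i → trans (f t i) (f′ t i)) , (λ i → trans (g i) (g′ i))
    }
  }
  where open Bidding

ValidBiddings : (k n : ℕ) → .{{_ : NonZero n}} → (Fin k → ℕ) → Setoid 0ℓ 0ℓ
ValidBiddings k n p =
  On.setoid {B = Σ (Bidding k n p) Valid} (Biddings k n p) proj₁

-- The mapping Ψ is given by its graph: `Ψ[ N ]≡ B` says that Ψ(N) is the
-- bidding B.

record Ψ[_]≡_ {k n : ℕ} .{{_ : NonZero k}} {p : Fin k → ℕ}
              (N : LabelledRootedNebula k n p) (B : Bidding k n p) : Set where
  open LabelledRootedNebula N
  open Bidding B
  field
    R-types : ∀ i t → (t ∈ R i) ⇔
      (∃ λ h → Σ (BlackBud h) λ b →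
        type h ≡ t × blackLabel (vertex h) (proj₂ b) ≡ i)
    ω-order : ∀ t a b → a < b → Precedes (t , ω t ⟨$⟩ʳ a) (t , ω t ⟨$⟩ʳ b)

private
  toℕ-next : ∀ {k} (t : Fin (suc k)) → toℕ (next t) ≡ suc (toℕ t) % suc k
  toℕ-next {k} t = toℕ-fromℕ< (m%n<n (suc (toℕ t)) (suc k))

  suc-% : ∀ m k → suc (m % suc k) % suc k ≡ suc m % suc k
  suc-% m k = trans (%-distribˡ-+ 1 (m % suc k) (suc k))
    (trans (cong (λ x → (1 % suc k + x) % suc k) %-idem)
      (sym (%-distribˡ-+ 1 m (suc k))))
    where
    %-idem : m % suc k % suc k ≡ m % suc k
    %-idem = m<n⇒m%n≡m (m%n<n m (suc k))

  toℕ-fold : ∀ {k} (t : Fin (suc k)) m →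
    toℕ (fold t next m) ≡ (m + toℕ t) % suc k
  toℕ-fold     t zero    = sym (m<n⇒m%n≡m (toℕ<n t))
  toℕ-fold {k} t (suc m) = trans (toℕ-next (fold t next m))
    (trans (cong (λ x → suc x % suc k) (toℕ-fold t m)) (suc-% (m + toℕ t) k))

  fold-next-k : ∀ {k} (t : Fin k) → fold t next k ≡ t
  fold-next-k {suc k} t = toℕ-injective (trans (toℕ-fold t (suc k))
    (trans (cong (_% suc k) (ℕ.+-comm (suc k) (toℕ t)))
      (trans ([m+n]%n≡m%n (toℕ t) (suc k)) (m<n⇒m%n≡m (toℕ<n t)))))

  Reaches : ∀ {k} → Fin k → Subset k → Fin k → Set
  Reaches t R u = ∃ λ r →
    (∀ j → 1 ℕ.≤ j → j ℕ.≤ r → fold t next j ∈ R) ×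
    fold t next (suc r) ∉ R × u ≡ fold t next r

  skip-reaches : ∀ {k} (t : Fin k) R → t ∉ R → ∀ m a → m + a ≡ k →
    (∀ j → 1 ℕ.≤ j → j ℕ.≤ a → fold t next j ∈ R) →
    Reaches t R (skip m (fold t next a) R)
  skip-reaches {suc k} t R t∉R zero a refl all =
    contradiction (subst (_∈ R) (fold-next-k t) (all a (s≤s z≤n) ℕ.≤-refl)) t∉R
  skip-reaches t R t∉R (suc m) a eq all with next (fold t next a) ∈? R
  ... | no  ∉R = a , all , ∉R , refl
  ... | yes ∈R = skip-reaches t R t∉R m (suc a) (trans (ℕ.+-suc m a) eq) all′
    where
    all′ : ∀ j → 1 ℕ.≤ j → j ℕ.≤ suc a → fold t next j ∈ R
    all′ j 1≤j j≤1+a with j ℕ.≟ suc a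
    ... | yes refl = ∈R
    ... | no  j≢   = all j 1≤j (ℕ.≤-pred (ℕ.≤∧≢⇒< j≤1+a j≢))

-- The defining property of α(t,R) for t ∉ R.

α-∉ : ∀ {k} (t : Fin k) (R : Subset k) → t ∉ R → ∃ λ r →
  (∀ j → 1 ℕ.≤ j → j ℕ.≤ r → fold t next j ∈ R) ×
  fold t next (suc r) ∉ R × α t R ≡ fold t next r
α-∉ {k} t R t∉R with t ∈? R
... | yes t∈R = contradiction t∈R t∉R
... | no  _   = skip-reaches t R t∉R k 0 (ℕ.+-identityʳ k) λ where
  _ (s≤s _) ()

{-# OPTIONS --safe #-}

-- Half-edges of a labelled nebula are determined by their colour, type and
-- label, and walking along the face from the white corner (t , i) one meets
-- the next white corner at type α(t , R i).  So a nebula amounts to an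
-- Eulerian tour of the balanced digraph on the types with one arc
-- t → α(t , R i) for each (t , i), and ω lists the exits from each type in
-- the order of the tour.  As in the BEST theorem, the greedy walk which always
-- takes the next exit is the only candidate for a tour with given orders, and
-- it exhausts all arcs exactly when the last exits from the types t ≠ k form
-- a tree: along the tour the last exits move forward, and conversely "all
-- exits are used" propagates from a type to those whose last exit leads to it.

module Submission where

open import Defs
open import Data.Bool.Base using (true)
open import Data.Empty using (⊥-elim)
open import Data.Fin.Base as Fin
  using (Fin; zero; suc; toℕ; fromℕ; fromℕ<; inject≤; punchOut; combine; remQuot)
open import Data.Fin.Permutation as Perm
  using (Permutation; Permutation′; permutation; _⟨$⟩ʳ_; _⟨$⟩ˡ_; inverseˡ; inverseʳ)
open import Data.Fin.Properties as Fin
  using (_≟_; any?; toℕ-injective; toℕ-fromℕ<; toℕ-fromℕ; toℕ<n; punchOut-injective;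
         injective⇒≤)
open import Data.Fin.Subset using (Subset; _∈_; _∉_)
open import Data.Fin.Subset.Properties using (_∈?_; ⊆⊤; ∈⊤; ⊆-antisym)
open import Data.List.Base
  using (List; []; _∷_; length; filter; allFin; lookup)
open import Data.List.Membership.Propositional using () renaming (_∈_ to _∈ₗ_)
open import Data.List.Membership.Propositional.Properties
  using (∈-filter⁺; ∈-filter⁻; ∈-lookup; ∈-allFin)
open import Data.List.Properties using (length-tabulate)
open import Data.List.Relation.Unary.AllPairs using (_∷_)
open import Data.List.Relation.Unary.Any as Any using (here; there)
open import Data.List.Relation.Unary.Any.Properties using (lookup-index)
open import Data.List.Relation.Unary.Unique.Propositional using (Unique)
open import Data.List.Relation.Unary.Unique.Propositional.Properties
  using (allFin⁺; filter⁺; Unique[x∷xs]⇒x∉xs)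
open import Data.Nat.Base as ℕ
  using (ℕ; zero; suc; _+_; _*_; _∸_; NonZero; _≤_; _<_; z≤n; s≤s)
open import Data.Nat.DivMod using (_%_; m%n<n; m<n⇒m%n≡m; [m+n]%n≡m%n; %-distribˡ-+)
open import Data.Nat.GeneralisedArithmetic using (fold; fold-+)
import Data.Nat.Induction as ℕ
import Data.Nat.Properties as ℕ
open import Data.Product.Base using (Σ; ∃; ∃₂; _×_; _,_; proj₁; proj₂)
open import Data.Sum.Base as Sum using (_⊎_; inj₁; inj₂)
import Data.Sum.Properties as Sum
open import Data.Vec.Base as Vec using ()
open import Data.Vec.Properties using (lookup∘tabulate; lookup⇒[]=; []=⇒lookup)
open import Function.Base using (_∘_; id; case_of_)
open import Function.Bundles using (Bijection; Equivalence; _⇔_; mk⇔)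
open import Function.Definitions using (Injective)
open import Induction.WellFounded using (Acc; acc)
open import Level using (0ℓ)
open import Relation.Binary.Bundles using (Setoid)
open import Relation.Binary.Construct.Closure.ReflexiveTransitive
  using (Star; ε; _◅_; _◅◅_)
open import Relation.Binary.Definitions using (DecidableEquality; tri<; tri≈; tri>)
open import Relation.Binary.PropositionalEquality
  using (_≡_; _≢_; refl; sym; trans; cong; cong₂; subst; module ≡-Reasoning)
open import Relation.Nullary.Decidable
  using (Dec; yes; no; does; _×-dec_; ¬?; decidable-stable; dec-true)
open import Relation.Nullary.Negation using (¬_; contradiction)
open import Relation.Unary using (Pred; Decidable)
open import Relation.Unary.Properties using (U?)

-- Counting and finite sets

-- The bidding fixes the types around a white vertex but not the labels, so neither the white
-- vertices nor the rotation at them can be read off directly. What is recovered is the face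
-- permutation `turn`. Since `mate` is an involution, the rotation is `turn` after `mate`, and the
-- white vertices are orbits of it. Hence the vertex set of a realisation is built as a quotient,
-- and injectivity is shown by matching two tours step by step. The tour is run on all half-edges
-- rather than on white corners alone. A black half-edge is an arc which is the only exit from a
-- vertex of its own, so a move across several black buds splits into single steps without choice,
-- and an Eulerian tour is itself a face permutation. Only arcs leaving the same type compete, and ω
-- ranks them. The numerical conditions (size, degree k, balance) enter by pigeonhole: they ensure
-- that every colour, type and label occurs on a half-edge. Positivity of p supplies a white vertex,
-- so by connectedness no black vertex carries only buds, which makes each R_i strict.

private
  variable
    a b k m n : ℕ

injective⇒surjective : {f : Fin m → Fin n} → Injective _≡_ _≡_ f → n ≤ m →
  ∀ y → ∃ λ x → f x ≡ y
injective⇒surjective {n = suc n} {f} inj n<m y with any? (λ x → f x ≟ y)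
... | yes hit  = hit
... | no  miss = contradiction n<m (ℕ.≤⇒≯ (injective⇒≤ punched))
  where
  y≢f : ∀ x → y ≢ f x
  y≢f x eq = miss (x , sym eq)

  punched : Injective _≡_ _≡_ (λ x → punchOut (y≢f x))
  punched {u} {v} eq = inj (punchOut-injective (y≢f u) (y≢f v) eq)

injective⇒permutation : (f : Fin m → Fin n) → Injective _≡_ _≡_ f → n ≤ m →
  Permutation m n
injective⇒permutation f inj n≤m =
  permutation f (λ y → proj₁ (hit y)) (λ y → proj₂ (hit y)) (λ x → inj (proj₂ (hit (f x))))
  where hit = injective⇒surjective inj n≤m

surjective⇒injective : {f : Fin m → Fin n} → m ≤ n → (∀ y → ∃ λ x → f x ≡ y) →
  Injective _≡_ _≡_ f
surjective⇒injective {f = f} m≤n sur {x} {y} eq =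
  trans (sym (inverse x)) (trans (cong section eq) (inverse y))
  where
  section = proj₁ ∘ sur

  section-injective : Injective _≡_ _≡_ section
  section-injective {u} {v} eq′ =
    trans (sym (proj₂ (sur u))) (trans (cong f eq′) (proj₂ (sur v)))

  inverse : ∀ x → section (f x) ≡ x
  inverse x with u , refl ← injective⇒surjective section-injective m≤n x =
    cong section (proj₂ (sur u))

⟨$⟩ʳ-injective : (π : Permutation m n) → Injective _≡_ _≡_ (π ⟨$⟩ʳ_)
⟨$⟩ʳ-injective π eq = trans (sym (inverseˡ π)) (trans (cong (π ⟨$⟩ˡ_) eq) (inverseˡ π))

lookup-injective : ∀ {A : Set} {xs : List A} → Unique xs → Injective _≡_ _≡_ (lookup xs)
lookup-injective {xs = _ ∷ _} _          {zero}  {zero}  _  = refl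
lookup-injective {xs = _ ∷ _} (_ ∷ uniq) {suc i} {suc j} eq =
  cong suc (lookup-injective uniq eq)
lookup-injective {xs = x ∷ xs} uniq {zero} {suc j} eq =
  contradiction (subst (_∈ₗ xs) (sym eq) (∈-lookup j)) (Unique[x∷xs]⇒x∉xs uniq)
lookup-injective {xs = x ∷ xs} uniq {suc i} {zero} eq =
  contradiction (subst (_∈ₗ xs) eq (∈-lookup i)) (Unique[x∷xs]⇒x∉xs uniq)

module _ {P : Pred (Fin m) 0ℓ} (P? : Decidable P) where

  -- Positions in the filtered list number the elements satisfying `P`, which turns equations
  -- between counts into pigeonhole arguments.
  element : Fin (count P?) → Fin m
  element = lookup (filter P? (allFin m))

  element-satisfies : ∀ i → P (element i)
  element-satisfies i = proj₂ (∈-filter⁻ P? {xs = allFin m} (∈-lookup i))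

  element-injective : Injective _≡_ _≡_ element
  element-injective = lookup-injective (filter⁺ P? (allFin⁺ m))

  rankOf : ∀ x → P x → Fin (count P?)
  rankOf x p = Any.index (∈-filter⁺ P? (∈-allFin x) p)

  element-rankOf : ∀ x p → element (rankOf x p) ≡ x
  element-rankOf x p = sym (lookup-index (∈-filter⁺ P? (∈-allFin x) p))

  count⇒∃ : 1 ≤ count P? → ∃ P
  count⇒∃ 1≤ = _ , element-satisfies (fromℕ< 1≤)

module _ {P : Pred (Fin a) 0ℓ} (P? : Decidable P) {Q : Pred (Fin b) 0ℓ} (Q? : Decidable Q)
         (f : ∀ x → P x → Fin b) (f-Q : ∀ x p → Q (f x p))
         (f-injective : ∀ x p y q → f x p ≡ f y q → x ≡ y) where

  private
    g : Fin (count P?) → Fin (count Q?)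
    g i = rankOf Q? _ (f-Q _ (element-satisfies P? i))

    element-g : ∀ i → element Q? (g i) ≡ f _ (element-satisfies P? i)
    element-g i = element-rankOf Q? _ _

    g-injective : Injective _≡_ _≡_ g
    g-injective {i} {j} eq = element-injective P? (f-injective _ _ _ _
      (trans (sym (element-g i)) (trans (cong (element Q?) eq) (element-g j))))

  count-≤ : count P? ≤ count Q?
  count-≤ = injective⇒≤ g-injective

  -- Draws existence statements from the size, the degree k and the balance of a nebula. The map `f`
  -- may depend on the proof of `P`, as labels are defined only for black vertices and white buds.
  count-≤⇒surjective : count Q? ≤ count P? → ∀ y → Q y → ∃ λ x → Σ (P x) λ p → f x p ≡ y
  count-≤⇒surjective Q≤P y q
    with i , eq ← injective⇒surjective g-injective Q≤P (rankOf Q? y q) =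
    _ , _ , trans (sym (element-g i)) (trans (cong (element Q?) eq) (element-rankOf Q? y q))

count-≡ : {P : Pred (Fin a) 0ℓ} (P? : Decidable P) {Q : Pred (Fin b) 0ℓ} (Q? : Decidable Q)
  (f : Fin a → Fin b) (g : Fin b → Fin a) → (∀ x → P x → Q (f x)) → (∀ y → Q y → P (g y)) →
  (∀ x → P x → g (f x) ≡ x) → (∀ y → Q y → f (g y) ≡ y) → count P? ≡ count Q?
count-≡ P? Q? f g f-Q g-P gf fg = ℕ.≤-antisym
  (count-≤ P? Q? (λ x _ → f x) f-Q
    λ x p y q eq → trans (sym (gf x p)) (trans (cong g eq) (gf y q)))
  (count-≤ Q? P? (λ y _ → g y) g-P
    λ x p y q eq → trans (sym (fg x p)) (trans (cong f eq) (fg y q)))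

count-U : ∀ m → count {m} U? ≡ m
count-U m = trans (cong length (filter-U (allFin m))) (length-tabulate id)
  where
  filter-U : (xs : List (Fin m)) → filter U? xs ≡ xs
  filter-U []       = refl
  filter-U (x ∷ xs) = cong (x ∷_) (filter-U xs)

-- Strictly increasing rearrangements

Increasing : (Fin n → ℕ) → Set
Increasing ρ = ∀ i j → i Fin.< j → ρ i < ρ j

increasing⇒<-reflecting : (ρ : Fin n → ℕ) → Increasing ρ → ∀ i j → ρ i < ρ j → i Fin.< j
increasing⇒<-reflecting ρ inc i j lt with Fin.<-cmp i j
... | tri< i<j _ _    = i<j
... | tri≈ _ refl _   = contradiction lt (ℕ.<-irrefl refl)
... | tri> _ _ j<i    = contradiction lt (ℕ.<-asym (inc j i j<i))

-- A value below its argument would start an infinite descent: `σ i < i` gives `σ (σ i) < σ i` by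
-- monotonicity, and so on.
increasing⇒≤ : (σ : Fin n → Fin n) → Increasing (toℕ ∘ σ) → ∀ i → toℕ i ≤ toℕ (σ i)
increasing⇒≤ σ inc i = ℕ.≮⇒≥ (not-below i (ℕ.<-wellFounded (toℕ i)))
  where
  not-below : ∀ i → Acc _<_ (toℕ i) → ¬ toℕ (σ i) < toℕ i
  not-below i (acc rs) σi<i = not-below (σ i) (rs σi<i) (inc _ _ σi<i)

-- The permutation π′⁻¹ ∘ π is increasing, and so is its inverse; `increasing⇒≤` applied to both
-- leaves only the identity. This is why the appearance order determines ω.
increasing-unique : (ρ : Fin n → ℕ) (π π′ : Permutation′ n) →
  Increasing (λ i → ρ (π ⟨$⟩ʳ i)) → Increasing (λ i → ρ (π′ ⟨$⟩ʳ i)) → π Perm.≈ π′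
increasing-unique ρ π π′ inc inc′ i = begin
  π  ⟨$⟩ʳ i                     ≡⟨ sym (inverseʳ π′) ⟩
  π′ ⟨$⟩ʳ (π′ ⟨$⟩ˡ (π ⟨$⟩ʳ i))  ≡⟨ cong (π′ ⟨$⟩ʳ_) (toℕ-injective (ℕ.≤-antisym below (increasing⇒≤ _ (mono π π′ inc inc′) i))) ⟩
  π′ ⟨$⟩ʳ i                     ∎
  where
  open ≡-Reasoning

  mono : (π π′ : Permutation′ _) →
    Increasing (λ i → ρ (π ⟨$⟩ʳ i)) → Increasing (λ i → ρ (π′ ⟨$⟩ʳ i)) →
    Increasing (λ i → toℕ (π′ ⟨$⟩ˡ (π ⟨$⟩ʳ i)))
  mono π π′ inc inc′ i j i<j = increasing⇒<-reflecting (λ i → ρ (π′ ⟨$⟩ʳ i)) inc′ _ _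
    (subst (λ x → ρ x < ρ (π′ ⟨$⟩ʳ (π′ ⟨$⟩ˡ (π ⟨$⟩ʳ j)))) (sym (inverseʳ π′))
      (subst (λ x → ρ (π ⟨$⟩ʳ i) < ρ x) (sym (inverseʳ π′)) (inc i j i<j)))

  below : toℕ (π′ ⟨$⟩ˡ (π ⟨$⟩ʳ i)) ≤ toℕ i
  below = subst (λ x → toℕ (π′ ⟨$⟩ˡ (π ⟨$⟩ʳ i)) ≤ toℕ x)
    (trans (cong (π ⟨$⟩ˡ_) (inverseʳ π′)) (inverseˡ π))
    (increasing⇒≤ _ (mono π′ π inc′ inc) _)

private module Sort (ρ : Fin n → ℕ) (ρ-injective : Injective _≡_ _≡_ ρ) where

  smaller? : ∀ i → Decidable (λ j → ρ j < ρ i)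
  smaller? i j = ρ j ℕ.<? ρ i

  opaque
    #smaller : Fin n → ℕ
    #smaller i = count (smaller? i)

    -- If the count did not grow, the inclusion of the elements below `i` in those below `j` would
    -- be onto, and `i` would lie below itself.
    #smaller-mono : ∀ {i j} → ρ i < ρ j → #smaller i < #smaller j
    #smaller-mono {i} {j} ρi<ρj = ℕ.≰⇒> λ j≤i →
      let x , x<i , x≡i = count-≤⇒surjective (smaller? i) (smaller? j) (λ x _ → x)
            (λ x x<i → ℕ.<-trans x<i ρi<ρj) (λ _ _ _ _ → id) j≤i i ρi<ρj
      in ℕ.<-irrefl (cong ρ x≡i) x<i

    #smaller<n : ∀ i → #smaller i < n
    #smaller<n i = ℕ.≰⇒> λ n≤ →
      let x , x<i , x≡i = count-≤⇒surjective (smaller? i) U? (λ x _ → x) (λ _ _ → _) (λ _ _ _ _ → id)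
                            (subst (_≤ #smaller i) (sym (count-U n)) n≤) i _
      in ℕ.<-irrefl (cong ρ x≡i) x<i

  #smaller-injective : ∀ {i j} → #smaller i ≡ #smaller j → i ≡ j
  #smaller-injective {i} {j} eq with ℕ.<-cmp (ρ i) (ρ j)
  ... | tri≈ _ ρi≡ρj _ = ρ-injective ρi≡ρj
  ... | tri< lt _ _    = contradiction (#smaller-mono lt) (ℕ.<-irrefl eq)
  ... | tri> _ _ gt    = contradiction (#smaller-mono gt) (ℕ.<-irrefl (sym eq))

  place : Fin n → Fin n
  place i = fromℕ< (#smaller<n i)

  toℕ-place : ∀ i → toℕ (place i) ≡ #smaller i
  toℕ-place i = toℕ-fromℕ< (#smaller<n i)

  opaque
    place-permutation : ∃ λ (π : Permutation′ n) → ∀ i → toℕ (π ⟨$⟩ʳ i) ≡ #smaller i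
    place-permutation = injective⇒permutation place
      (λ {i} {j} eq → #smaller-injective (trans (sym (toℕ-place i)) (trans (cong toℕ eq) (toℕ-place j))))
      ℕ.≤-refl , toℕ-place

  increasing : Increasing (λ i → ρ (proj₁ place-permutation ⟨$⟩ˡ i))
  increasing i j i<j with π , eq ← place-permutation with ℕ.<-cmp (ρ (π ⟨$⟩ˡ i)) (ρ (π ⟨$⟩ˡ j))
  ... | tri< lt _ _ = lt
  ... | tri≈ _ e _  = contradiction i<j (ℕ.<-irrefl (cong toℕ (⟨$⟩ʳ-injective (Perm.flip π) (ρ-injective e))))
  ... | tri> _ _ gt = contradiction (#smaller-mono gt) (ℕ.<-asym
    (subst (_< #smaller (π ⟨$⟩ˡ j)) (value i) (subst (toℕ i <_) (value j) i<j)))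
    where
    value : ∀ i → toℕ i ≡ #smaller (π ⟨$⟩ˡ i)
    value i = trans (cong toℕ (sym (inverseʳ π))) (eq (π ⟨$⟩ˡ i))

sort : (ρ : Fin n → ℕ) → Injective _≡_ _≡_ ρ →
  ∃ λ (π : Permutation′ n) → Increasing (λ i → ρ (π ⟨$⟩ʳ i))
sort ρ ρ-injective = Perm.flip (proj₁ place-permutation) , increasing
  where open Sort ρ ρ-injective

-- Cyclic successors

%-absorbˡ : ∀ m n d .{{_ : NonZero d}} → (m % d + n) % d ≡ (m + n) % d
%-absorbˡ m n d = begin
  (m % d + n) % d           ≡⟨ %-distribˡ-+ (m % d) n d ⟩
  (m % d % d + n % d) % d   ≡⟨ cong (λ x → (x + n % d) % d) (m<n⇒m%n≡m (m%n<n m d)) ⟩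
  (m % d + n % d) % d       ≡⟨ sym (%-distribˡ-+ m n d) ⟩
  (m + n) % d               ∎
  where open ≡-Reasoning

toℕ-next : (t : Fin (suc k)) → toℕ (next t) ≡ suc (toℕ t) % suc k
toℕ-next {k} t = toℕ-fromℕ< (m%n<n (suc (toℕ t)) (suc k))

toℕ-prev : (t : Fin (suc k)) → toℕ (prev t) ≡ (toℕ t + k) % suc k
toℕ-prev {k} t = toℕ-fromℕ< (m%n<n (toℕ t + k) (suc k))

toℕ-%-full : (t : Fin (suc k)) → (toℕ t + suc k) % suc k ≡ toℕ t
toℕ-%-full {k} t = trans ([m+n]%n≡m%n (toℕ t) (suc k)) (m<n⇒m%n≡m (toℕ<n t))

prev-next : (t : Fin k) → prev (next t) ≡ t
prev-next {suc k} t = toℕ-injective (begin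
  toℕ (prev (next t))                ≡⟨ toℕ-prev (next t) ⟩
  (toℕ (next t) + k) % suc k         ≡⟨ cong (λ x → (x + k) % suc k) (toℕ-next t) ⟩
  (suc (toℕ t) % suc k + k) % suc k  ≡⟨ %-absorbˡ (suc (toℕ t)) k (suc k) ⟩
  (suc (toℕ t) + k) % suc k          ≡⟨ cong (_% suc k) (sym (ℕ.+-suc (toℕ t) k)) ⟩
  (toℕ t + suc k) % suc k            ≡⟨ toℕ-%-full t ⟩
  toℕ t                              ∎)
  where open ≡-Reasoning

next-prev : (t : Fin k) → next (prev t) ≡ t
next-prev {suc k} t = toℕ-injective (begin
  toℕ (next (prev t))                ≡⟨ toℕ-next (prev t) ⟩
  suc (toℕ (prev t)) % suc k         ≡⟨ cong (λ x → suc x % suc k) (toℕ-prev t) ⟩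
  suc ((toℕ t + k) % suc k) % suc k  ≡⟨ cong (_% suc k) (ℕ.+-comm 1 _) ⟩
  ((toℕ t + k) % suc k + 1) % suc k  ≡⟨ %-absorbˡ (toℕ t + k) 1 (suc k) ⟩
  (toℕ t + k + 1) % suc k            ≡⟨ cong (_% suc k) (trans (ℕ.+-assoc (toℕ t) k 1) (cong (toℕ t +_) (ℕ.+-comm k 1))) ⟩
  (toℕ t + suc k) % suc k            ≡⟨ toℕ-%-full t ⟩
  toℕ t                              ∎)
  where open ≡-Reasoning

next-transitive : (t u : Fin k) → ∃ λ m → fold t next m ≡ u
-- `suc k ∸ toℕ t` steps complete the turn from `t` to the first type and `toℕ u` more lead to `u`,
-- which avoids comparing `t` with `u`.
next-transitive {suc k} t u = toℕ u + (suc k ∸ toℕ t) , toℕ-injective (begin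
  toℕ (fold t next (toℕ u + (suc k ∸ toℕ t)))    ≡⟨ toℕ-fold (toℕ u + (suc k ∸ toℕ t)) ⟩
  (toℕ u + (suc k ∸ toℕ t) + toℕ t) % suc k     ≡⟨ cong (_% suc k) (trans (ℕ.+-assoc (toℕ u) _ _)
                                                     (cong (toℕ u +_) (ℕ.m∸n+n≡m (ℕ.<⇒≤ (toℕ<n t))))) ⟩
  (toℕ u + suc k) % suc k                       ≡⟨ toℕ-%-full u ⟩
  toℕ u                                         ∎)
  where
  open ≡-Reasoning

  toℕ-fold : ∀ m → toℕ (fold t next m) ≡ (m + toℕ t) % suc k
  toℕ-fold zero    = sym (m<n⇒m%n≡m (toℕ<n t))
  toℕ-fold (suc m) = begin
    toℕ (next (fold t next m))              ≡⟨ toℕ-next (fold t next m) ⟩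
    suc (toℕ (fold t next m)) % suc k       ≡⟨ cong (λ x → suc x % suc k) (toℕ-fold m) ⟩
    suc ((m + toℕ t) % suc k) % suc k       ≡⟨ cong (_% suc k) (ℕ.+-comm 1 _) ⟩
    ((m + toℕ t) % suc k + 1) % suc k       ≡⟨ %-absorbˡ (m + toℕ t) 1 (suc k) ⟩
    (m + toℕ t + 1) % suc k                 ≡⟨ cong (_% suc k) (ℕ.+-comm (m + toℕ t) 1) ⟩
    (suc m + toℕ t) % suc k                 ∎

-- Orbits

fold-commute : ∀ {A : Set} (x : A) f m → fold (f x) f m ≡ f (fold x f m)
fold-commute x f zero    = refl
fold-commute x f (suc m) = cong f (fold-commute x f m)

fold-split : ∀ {A : Set} (x : A) f {i j} → i ≤ j → fold (fold x f i) f (j ∸ i) ≡ fold x f j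
fold-split x f {i} {j} i≤j =
  trans (sym (fold-+ x f (j ∸ i) {i})) (cong (fold x f) (ℕ.m∸n+n≡m i≤j))

module _ {A : Set} {f : A → A} {x : A} {p : ℕ} (1≤p : 1 ≤ p) (period : fold x f p ≡ x) where

  reduce : ∀ m → ∃ λ j → j < p × fold x f j ≡ fold x f m
  reduce zero = 0 , 1≤p , refl
  reduce (suc m) with reduce m
  ... | j , j<p , eq with suc j ℕ.≟ p
  ...   | yes refl = 0 , 1≤p , trans (sym period) (cong f eq)
  ...   | no  j≢   = suc j , ℕ.≤∧≢⇒< j<p j≢ , cong f eq

  orbit-reverse : ∀ {y} m → fold x f m ≡ y → ∃ λ m′ → fold y f m′ ≡ x
  orbit-reverse m refl with j , j<p , eq ← reduce m =
    p ∸ j , trans (cong (λ z → fold z f (p ∸ j)) (sym eq))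
                  (trans (fold-split x f (ℕ.<⇒≤ j<p)) period)

module Cyclic {N} (f : Fin N → Fin N) (transitive : ∀ x y → ∃ λ m → fold x f m ≡ y) (s : Fin N) where

  private
    -- A repetition gives the orbit of `x` the period `j ∸ i`, which is less than N because times
    -- start at 1; but by transitivity this orbit has N elements.
    not-equal : ∀ {i j} → 1 ≤ i → i < j → j ≤ N → fold s f i ≢ fold s f j
    not-equal {i} {j} 1≤i i<j j≤N eq = contradiction N≤p (ℕ.<⇒≱ p<N)
      where
      x = fold s f i
      p = j ∸ i

      period : fold x f p ≡ x
      period = trans (fold-split s f (ℕ.<⇒≤ i<j)) (sym eq)

      index : ∀ y → ∃ λ c → c < p × fold x f c ≡ y
      index y with m , refl ← transitive x y = reduce (ℕ.m<n⇒0<n∸m i<j) period m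

      index-injective : Injective _≡_ _≡_ (λ y → fromℕ< (proj₁ (proj₂ (index y))))
      index-injective {y} {z} eq′ = trans (sym (proj₂ (proj₂ (index y))))
        (trans (cong (fold x f) (trans (sym (toℕ-fromℕ< _)) (trans (cong toℕ eq′) (toℕ-fromℕ< _))))
          (proj₂ (proj₂ (index z))))

      N≤p : N ≤ p
      N≤p = injective⇒≤ index-injective

      p<N : p < N
      p<N = ℕ.<-≤-trans (ℕ.∸-monoʳ-< 1≤i (ℕ.<⇒≤ i<j)) j≤N

  fold-injective : ∀ {i j} → 1 ≤ i → i ≤ N → 1 ≤ j → j ≤ N → fold s f i ≡ fold s f j → i ≡ j
  fold-injective {i} {j} 1≤i i≤N 1≤j j≤N eq with ℕ.<-cmp i j
  ... | tri< i<j _ _ = contradiction eq (not-equal 1≤i i<j j≤N)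
  ... | tri≈ _ i≡j _ = i≡j
  ... | tri> _ _ j<i = contradiction (sym eq) (not-equal 1≤j j<i i≤N)

  private
    visit : ∀ y → ∃ λ (i : Fin N) → fold s f (suc (toℕ i)) ≡ y
    visit = injective⇒surjective
      (λ {i} {j} eq → toℕ-injective (ℕ.suc-injective
        (fold-injective (s≤s z≤n) (toℕ<n i) (s≤s z≤n) (toℕ<n j) eq)))
      ℕ.≤-refl

  -- Times run over 1, ..., N instead of 0, ..., N - 1, so that `s` comes last, as the pair of k and
  -- the root label does in the appearance order.
  pos : Fin N → ℕ
  pos y = suc (toℕ (proj₁ (visit y)))

  1≤pos : ∀ y → 1 ≤ pos y
  1≤pos y = s≤s z≤n

  pos≤N : ∀ y → pos y ≤ N
  pos≤N y = toℕ<n (proj₁ (visit y))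

  fold-pos : ∀ y → fold s f (pos y) ≡ y
  fold-pos y = proj₂ (visit y)

  pos-fold : ∀ {i} → 1 ≤ i → i ≤ N → pos (fold s f i) ≡ i
  pos-fold 1≤i i≤N = fold-injective (1≤pos _) (pos≤N _) 1≤i i≤N (fold-pos _)

  pos-injective : Injective _≡_ _≡_ pos
  pos-injective {x} {y} eq = trans (sym (fold-pos x)) (trans (cong (fold s f) eq) (fold-pos y))

  -- Otherwise `f s` would be met at time 1 and again just after `s`, at a later time that is still
  -- at most N.
  pos-start : pos s ≡ N
  pos-start with ℕ.m≤n⇒m<n∨m≡n (pos≤N s)
  ... | inj₂ eq = eq
  ... | inj₁ <N = contradiction
    (fold-injective (s≤s z≤n) <N (s≤s z≤n) (ℕ.≤-trans (1≤pos s) (pos≤N s)) (cong f (fold-pos s)))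
    λ ()

  fold-N : fold s f N ≡ s
  fold-N = trans (cong (fold s f) (sym pos-start)) (fold-pos s)

  pos-step : ∀ {y} → y ≢ s → pos (f y) ≡ suc (pos y)
  pos-step {y} y≢s = trans (cong (pos ∘ f) (sym (fold-pos y))) (pos-fold (s≤s z≤n) pos<N)
    where
    pos<N : pos y < N
    pos<N = ℕ.≤∧≢⇒< (pos≤N y) λ eq →
      y≢s (trans (sym (fold-pos y)) (trans (cong (fold s f) eq) fold-N))

  fold-before : ∀ y → ∃ λ j → j < N × fold s f j ≡ y
  fold-before y
    with j , j<N , eq ← reduce {f = f} (ℕ.≤-trans (1≤pos s) (pos≤N s)) fold-N (pos y) =
    j , j<N , trans eq (fold-pos y)

-- Quotients of finite sets

-- The vertices of a `Map` are numbered, so orbits must be numbered too; `repr` lets the colour and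
-- label of an orbit be read from one half-edge.
record Quotient {m} (_~_ : Fin m → Fin m → Set) : Set where
  field
    #classes : ℕ
    class    : Fin m → Fin #classes
    repr     : Fin #classes → Fin m
    class-repr : ∀ v → class (repr v) ≡ v
    effective  : ∀ {x y} → class x ≡ class y → x ~ y
    sound      : ∀ {x y} → x ~ y → class x ≡ class y

quotient : ∀ {m} (_~_ : Fin m → Fin m → Set) → (∀ x y → Dec (x ~ y)) →
  (∀ {x} → x ~ x) → (∀ {x y} → x ~ y → y ~ x) → (∀ {x y z} → x ~ y → y ~ z → x ~ z) →
  Quotient _~_
quotient {zero} _~_ _ _ _ _ = record
  { #classes = 0 ; class = λ () ; repr = λ () ; class-repr = λ ()
  ; effective = λ {x} → ⊥-elim (Fin.¬Fin0 x) ; sound = λ {x} → ⊥-elim (Fin.¬Fin0 x) }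
quotient {suc m} _~_ _~?_ ~-refl ~-sym ~-trans
  with any? (λ j → zero ~? suc j)
     | quotient (λ x y → suc x ~ suc y) (λ x y → suc x ~? suc y) ~-refl ~-sym ~-trans
... | yes (j , 0~j) | Q = record
  { #classes = #classes ; class = class′ ; repr = suc ∘ repr ; class-repr = class-repr
  ; effective = effective′ ; sound = sound′ }
  where
  open Quotient Q

  class′ : Fin (suc m) → Fin #classes
  class′ zero    = class j
  class′ (suc x) = class x

  effective′ : ∀ {x y} → class′ x ≡ class′ y → x ~ y
  effective′ {zero}  {zero}  _  = ~-refl
  effective′ {zero}  {suc y} eq = ~-trans 0~j (effective eq)
  effective′ {suc x} {zero}  eq = ~-trans (effective eq) (~-sym 0~j)
  effective′ {suc x} {suc y} eq = effective eq

  sound′ : ∀ {x y} → x ~ y → class′ x ≡ class′ y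
  sound′ {zero}  {zero}  _ = refl
  sound′ {zero}  {suc y} r = sound (~-trans (~-sym 0~j) r)
  sound′ {suc x} {zero}  r = sound (~-trans r 0~j)
  sound′ {suc x} {suc y} r = sound r
... | no alone | Q = record
  { #classes = suc #classes ; class = class′ ; repr = repr′ ; class-repr = class-repr′
  ; effective = effective′ ; sound = sound′ }
  where
  open Quotient Q

  class′ : Fin (suc m) → Fin (suc #classes)
  class′ zero    = zero
  class′ (suc x) = suc (class x)

  repr′ : Fin (suc #classes) → Fin (suc m)
  repr′ zero    = zero
  repr′ (suc v) = suc (repr v)

  class-repr′ : ∀ v → class′ (repr′ v) ≡ v
  class-repr′ zero    = refl
  class-repr′ (suc v) = cong suc (class-repr v)

  effective′ : ∀ {x y} → class′ x ≡ class′ y → x ~ y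
  effective′ {zero}  {zero}  _  = ~-refl
  effective′ {suc x} {suc y} eq = effective (Fin.suc-injective eq)

  sound′ : ∀ {x y} → x ~ y → class′ x ≡ class′ y
  sound′ {zero}  {zero}  _ = refl
  sound′ {zero}  {suc y} r = contradiction (y , r) alone
  sound′ {suc x} {zero}  r = contradiction (x , ~-sym r) alone
  sound′ {suc x} {suc y} r = cong suc (sound r)

module Orbits {N} (π : Permutation′ N) where

  private
    f = π ⟨$⟩ʳ_

    cancel : ∀ {x} i {y} → fold x f i ≡ fold y f i → x ≡ y
    cancel zero    eq = eq
    cancel (suc i) eq = cancel i (⟨$⟩ʳ-injective π eq)

    period : ∀ x → ∃ λ p → 1 ≤ p × p ≤ N × fold x f p ≡ x
    period x with i , j , i<j , eq ← Fin.pigeonhole (ℕ.n<1+n N) (λ i → fold x f (toℕ i)) =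
      toℕ j ∸ toℕ i , ℕ.m<n⇒0<n∸m i<j , ℕ.≤-trans (ℕ.m∸n≤m (toℕ j) (toℕ i)) (ℕ.≤-pred (toℕ<n j)) ,
      sym (cancel (toℕ i) (trans eq (trans (cong (fold x f) (sym (ℕ.m+[n∸m]≡n (ℕ.<⇒≤ i<j))))
        (fold-+ x f (toℕ i)))))

  _~_ : Fin N → Fin N → Set
  x ~ y = ∃ λ m → fold x f m ≡ y

  -- By the pigeonhole principle every point has a period of at most N, so a bounded search decides
  -- the relation.
  _~?_ : ∀ x y → Dec (x ~ y)
  x ~? y with p , 1≤p , p≤N , eq ← period x | any? {N} (λ m → fold x f (toℕ m) ≟ y)
  ... | yes (m , eq′) = yes (toℕ m , eq′)
  ... | no none = no λ (m , eq′) →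
    let j , j<p , eq″ = reduce {f = f} 1≤p eq m
        j<N = ℕ.<-≤-trans j<p p≤N
    in none (fromℕ< j<N , trans (cong (fold x f) (toℕ-fromℕ< j<N)) (trans eq″ eq′))

  opaque
    orbits : Quotient _~_
    orbits = quotient _~_ _~?_ (0 , refl)
      (λ {x} (m , eq) → let _ , 1≤p , _ , per = period x in orbit-reverse {f = f} 1≤p per m eq)
      (λ {x} (m , eq) (m′ , eq′) → m′ + m , trans (fold-+ x f m′) (trans (cong (λ z → fold z f m′) eq) eq′))

-- Half-edges of a nebula are determined by colour, type and label

opposite : Colour → Colour
opposite black = white
opposite white = black

opposite-unique : ∀ {c d} → d ≢ c → d ≡ opposite c
opposite-unique {black} {black} d≢c = contradiction refl d≢c
opposite-unique {black} {white} _   = refl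
opposite-unique {white} {black} _   = refl
opposite-unique {white} {white} d≢c = contradiction refl d≢c

white≢black : ∀ {c} → c ≡ white → c ≢ black
white≢black refl ()

module Frame {k n} {p : Fin (suc k) → ℕ} (N : LabelledRootedNebula (suc k) n p) where
  open LabelledRootedNebula N public

  private
    K = suc k

  colourOf : H → Colour
  colourOf h = colour (vertex h)

  mate-nonBud : ∀ {h} → ¬ Bud h → ¬ Bud (mate h)
  mate-nonBud {h} ¬bud eq = ¬bud (trans (sym eq) (mate-involutive h))

  colourOf-mate : ∀ {h} → ¬ Bud h → colourOf (mate h) ≡ opposite (colourOf h)
  colourOf-mate ¬bud = opposite-unique (bipartite _ ¬bud)

  vertex-rot : ∀ h → vertex (rot h) ≡ vertex h
  vertex-rot h = sym (Equivalence.from (rot-cyclic h (rot h)) (1 , refl))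

  blackLabel-cong : ∀ {u v} → u ≡ v → (b : Black u) (c : Black v) → blackLabel u b ≡ blackLabel v c
  blackLabel-cong refl _ _ = refl

  data Labelled (h : H) (i : Fin n) : Set where
    atBlack : (b : Black (vertex h)) → blackLabel (vertex h) b ≡ i → Labelled h i
    atWhite : Object (type h) i h → Labelled h i

  object-white : ∀ {t i w} → Object t i w → White (vertex w)
  object-white (edge w _ _ _)    = w
  object-white (bud (_ , w) _ _) = w

  object-type : ∀ {t i w} → Object t i w → type w ≡ t
  object-type (edge _ _ eq _) = eq
  object-type (bud _ eq _)    = eq

  object⇒labelled : ∀ {t i w} → Object t i w → Labelled w i
  object⇒labelled (edge w b _ eq) = atWhite (edge w b refl eq)
  object⇒labelled (bud b _ eq)    = atWhite (bud b refl eq)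

  edge-nonBud : ∀ {w} → White (vertex w) → Black (vertex (mate w)) → ¬ Bud w
  edge-nonBud w b eq = white≢black w (trans (cong colourOf (sym eq)) b)

  opaque
    objectOf : ∀ {w} → White (vertex w) → ∃ λ i → Object (type w) i w
    objectOf {w} w-white with mate w ≟ w
    ... | yes b = _ , bud (b , w-white) refl refl
    ... | no ¬b = _ , edge w-white (trans (colourOf-mate ¬b) (cong opposite w-white)) refl refl

  opaque
    labelled : ∀ h → ∃ (Labelled h)
    labelled h with colourOf h in eq
    ... | black = _ , atBlack eq refl
    ... | white with i , o ← objectOf eq = i , atWhite o

  label : H → Fin n
  label h = proj₁ (labelled h)

  labelled-unique : ∀ {h i j} → Labelled h i → Labelled h j → i ≡ j
  labelled-unique (atBlack _ p) (atBlack _ q) = trans (sym p) q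
  labelled-unique (atBlack b _) (atWhite o)   = contradiction b (white≢black (object-white o))
  labelled-unique (atWhite o)   (atBlack b _) = contradiction b (white≢black (object-white o))
  labelled-unique (atWhite (edge _ _ _ p)) (atWhite (edge _ _ _ q)) = trans (sym p) q
  labelled-unique (atWhite (edge w b _ _)) (atWhite (bud (m , _) _ _)) = contradiction m (edge-nonBud w b)
  labelled-unique (atWhite (bud (m , _) _ _)) (atWhite (edge w b _ _)) = contradiction m (edge-nonBud w b)
  labelled-unique (atWhite (bud _ _ p)) (atWhite (bud _ _ q)) = trans (sym p) q

  label-mate : ∀ {h} → ¬ Bud h → label (mate h) ≡ label h
  label-mate {h} ¬bud with labelled h
  ... | i , atBlack b eq = labelled-unique (proj₂ (labelled (mate h)))
    (atWhite (edge (trans (colourOf-mate ¬bud) (cong opposite b))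
                   (trans (cong colourOf (mate-involutive h)) b) refl
                   (trans (blackLabel-cong (cong vertex (mate-involutive h)) (trans (cong colourOf (mate-involutive h)) b) b) eq)))
  ... | i , atWhite (edge _ b _ eq)   = labelled-unique (proj₂ (labelled (mate h))) (atBlack b eq)
  ... | i , atWhite (bud (m , _) _ _) = contradiction m ¬bud

  label-black : ∀ h (b : Black (vertex h)) → blackLabel (vertex h) b ≡ label h
  label-black h b = labelled-unique (atBlack b refl) (proj₂ (labelled h))

  label-bud : ∀ h (b : WhiteBud h) → budLabel h b ≡ label h
  label-bud h b = labelled-unique (atWhite (bud b refl refl)) (proj₂ (labelled h))

  private
    fold-rot : ∀ g → Black (vertex g) → ∀ m →
      vertex (fold g rot m) ≡ vertex g × type (fold g rot m) ≡ fold (type g) next m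
    fold-rot g b zero    = refl , refl
    fold-rot g b (suc m) with v , t ← fold-rot g b m =
      trans (vertex-rot _) v , trans (black-types _ (trans (cong colour v) b)) (cong next t)

    opaque
      atVertex : ∀ v → Black v → ∀ t → ∃ λ h → vertex h ≡ v × type h ≡ t
      atVertex v b t
        with g , refl ← count⇒∃ (λ h → vertex h ≟ v) (subst (1 ≤_) (sym (black-degree v b)) (s≤s z≤n))
        with m , eq ← next-transitive (type g) t =
        fold g rot m , proj₁ (fold-rot g b m) , trans (proj₂ (fold-rot g b m)) eq

    -- The half-edges supplied by `atVertex` have k distinct types, and the degree is k, so they
    -- exhaust the vertex.
    atVertex-complete : ∀ h (b : Black (vertex h)) → h ≡ proj₁ (atVertex (vertex h) b (type h))
    atVertex-complete h b = case
      count-≤⇒surjective U? (λ g → vertex g ≟ vertex h) (λ t _ → proj₁ (section t))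
        (λ t _ → proj₁ (proj₂ (section t)))
        (λ t _ u _ eq → trans (sym (proj₂ (proj₂ (section t)))) (trans (cong type eq) (proj₂ (proj₂ (section u)))))
        (ℕ.≤-reflexive (trans (black-degree (vertex h) b) (sym (count-U K)))) h refl
      of λ (t , _ , eq) → trans (sym eq)
        (cong (proj₁ ∘ section) (trans (sym (proj₂ (proj₂ (section t)))) (cong type eq)))
      where section = atVertex (vertex h) b

  black-injective : ∀ {g h} → Black (vertex g) → Black (vertex h) →
    type g ≡ type h → label g ≡ label h → g ≡ h
  black-injective {g} {h} b c tt ll = trans (atVertex-complete g b)
    (trans (same same-vertex b c tt) (sym (atVertex-complete h c)))
    where
    same-vertex : vertex g ≡ vertex h
    same-vertex = blackLabel-injective _ _ b c (trans (label-black g b) (trans ll (sym (label-black h c))))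

    same : ∀ {u v} → u ≡ v → (b : Black u) (c : Black v) → ∀ {t t′} → t ≡ t′ →
      proj₁ (atVertex u b t) ≡ proj₁ (atVertex v c t′)
    same {u} refl b c {t} refl = cong (λ b → proj₁ (atVertex u b t)) (irrelevant b c)
      where
      irrelevant : ∀ {c : Colour} (p q : c ≡ black) → p ≡ q
      irrelevant refl refl = refl

  private
    -- This rests on white bud labels lying in L_t: the black bud matched with `w′` would share type
    -- and label with the black end of `w`, and so coincide with it by `black-injective`.
    edge≢bud : ∀ {w w′} → ¬ Bud w → (b : WhiteBud w′) → White (vertex w) →
      type w ≡ type w′ → label w ≢ label w′
    edge≢bud {w} {w′} ¬bud b w-white tt ll with budLabel-matched w′ b
    ... | g , (gbud , gblack) , gt , gl = mate-nonBud ¬bud (subst Bud (black-injective gblack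
      (trans (colourOf-mate ¬bud) (cong opposite w-white)) (trans gt (trans (sym tt) (sym (type-mate w))))
      (begin
        label g                    ≡⟨ sym (label-black g gblack) ⟩
        blackLabel (vertex g) _    ≡⟨ gl ⟩
        budLabel w′ b              ≡⟨ label-bud w′ b ⟩
        label w′                   ≡⟨ sym ll ⟩
        label w                    ≡⟨ sym (label-mate ¬bud) ⟩
        label (mate w)             ∎)) gbud)
      where open ≡-Reasoning

  white-injective : ∀ {g h} → White (vertex g) → White (vertex h) →
    type g ≡ type h → label g ≡ label h → g ≡ h
  white-injective {g} {h} w w′ tt ll with mate g ≟ g | mate h ≟ h
  ... | yes gb | yes hb = budLabel-injective g h (gb , w) (hb , w′) tt
    (trans (label-bud g (gb , w)) (trans ll (sym (label-bud h (hb , w′)))))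
  ... | yes gb | no ¬hb = contradiction (sym ll) (edge≢bud ¬hb (gb , w) w′ (sym tt))
  ... | no ¬gb | yes hb = contradiction ll (edge≢bud ¬gb (hb , w′) w tt)
  ... | no ¬gb | no ¬hb = trans (sym (mate-involutive g)) (trans (cong mate
    (black-injective (trans (colourOf-mate ¬gb) (cong opposite w)) (trans (colourOf-mate ¬hb) (cong opposite w′))
      (trans (type-mate g) (trans tt (sym (type-mate h))))
      (trans (label-mate ¬gb) (trans ll (sym (label-mate ¬hb)))))) (mate-involutive h))

  coordinates-injective : ∀ {g h} → colourOf g ≡ colourOf h →
    type g ≡ type h → label g ≡ label h → g ≡ h
  coordinates-injective {g} {h} cc = by-colour (colourOf h) cc refl
    where
    by-colour : ∀ c → colourOf g ≡ c → colourOf h ≡ c → type g ≡ type h → label g ≡ label h → g ≡ h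
    by-colour black = black-injective
    by-colour white = white-injective

  At : Colour → Fin K → Fin n → H → Set
  At c t i h = colourOf h ≡ c × type h ≡ t × label h ≡ i

  private
    opaque
      vertexLabelled : ∀ i → ∃ λ v → Σ (Black v) λ b → blackLabel v b ≡ i
      vertexLabelled i = count-≤⇒surjective (λ v → colour v ≟ᶜ black) U? (λ v b → blackLabel v b)
        (λ _ _ → _) (λ u b v c → blackLabel-injective u v b c) (ℕ.≤-reflexive (trans (count-U n) (sym size))) i _

    opaque
      blackAt : ∀ t i → ∃ (At black t i)
      blackAt t i with v , b , refl ← vertexLabelled i with h , refl , ht ← atVertex v b t =
        h , b , ht , sym (label-black h b)

    opaque
      -- Matching sends the white buds of a type injectively to the black buds of that type; balance
      -- makes it onto.
      whiteBudOf : ∀ g → BlackBud g → ∃ λ w → WhiteBud w × type w ≡ type g × label w ≡ label g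
      whiteBudOf g b = case
        count-≤⇒surjective (buds? white) (buds? black)
          (λ w (b , tt) → proj₁ (budLabel-matched w b))
          (λ w (b , tt) → let _ , b′ , tt′ , _ = budLabel-matched w b in b′ , trans tt′ tt)
          (λ w (b , tt) w′ (b′ , tt′) eq → white-injective (proj₂ b) (proj₂ b′) (trans tt (sym tt′))
            (trans (sym (label-matched w b)) (trans (cong label eq) (label-matched w′ b′))))
          (ℕ.≤-reflexive (balanced (type g))) g (b , refl)
        of λ (w , (b , tt) , eq) → w , b , tt , trans (sym (label-matched w b)) (cong label eq)
        where
        buds? : ∀ c → Decidable (λ h → (Bud h × colourOf h ≡ c) × type h ≡ type g)
        buds? c h = ((mate h ≟ h) ×-dec (colour (vertex h) ≟ᶜ c)) ×-dec (type h ≟ type g)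

        label-matched : ∀ w b → label (proj₁ (budLabel-matched w b)) ≡ label w
        label-matched w b with h , (_ , hblack) , _ , eq ← budLabel-matched w b =
          trans (sym (label-black h hblack))
            (trans eq (label-bud w b))

    opaque
      whiteAt : ∀ t i → ∃ (At white t i)
      whiteAt t i with blackAt t i
      ... | g , b , refl , refl with mate g ≟ g
      ...   | no ¬bud = mate g , trans (colourOf-mate ¬bud) (cong opposite b) , type-mate g , label-mate ¬bud
      ...   | yes m with w , (_ , w-white) , tt , ll ← whiteBudOf g (m , b) = w , w-white , tt , ll

    opaque
      halfAt : ∀ c t i → ∃ (At c t i)
      halfAt black = blackAt
      halfAt white = whiteAt

  half : Colour → Fin K → Fin n → H
  half c t i = proj₁ (halfAt c t i)

  colour-half : ∀ c t i → colourOf (half c t i) ≡ c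
  colour-half c t i = proj₁ (proj₂ (halfAt c t i))

  type-half : ∀ c t i → type (half c t i) ≡ t
  type-half c t i = proj₁ (proj₂ (proj₂ (halfAt c t i)))

  label-half : ∀ c t i → label (half c t i) ≡ i
  label-half c t i = proj₂ (proj₂ (proj₂ (halfAt c t i)))

  half-unique : ∀ {c t i h} → colourOf h ≡ c → type h ≡ t → label h ≡ i → h ≡ half c t i
  half-unique {c} {t} {i} cc tt ll = coordinates-injective (trans cc (sym (colour-half c t i)))
    (trans tt (sym (type-half c t i))) (trans ll (sym (label-half c t i)))

  object⇒half : ∀ {t i w} → Object t i w → w ≡ half white t i
  object⇒half o = half-unique (object-white o) (object-type o)
    (labelled-unique (proj₂ (labelled _)) (object⇒labelled o))

  half-object : ∀ t i → Object t i (half white t i)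
  half-object t i with j , o ← objectOf (colour-half white t i)
    with refl ← trans (labelled-unique (atWhite o) (proj₂ (labelled _))) (label-half white t i) =
    relabel (type-half white t i) o
    where
    relabel : ∀ {t u j w} → t ≡ u → Object t j w → Object u j w
    relabel refl o = o

  mate-half : ∀ {c t i} → ¬ Bud (half c t i) → mate (half c t i) ≡ half (opposite c) t i
  mate-half {c} {t} {i} ¬bud = half-unique
    (trans (colourOf-mate ¬bud) (cong opposite (colour-half c t i)))
    (trans (type-mate (half c t i)) (type-half c t i)) (trans (label-mate ¬bud) (label-half c t i))

  -- Used for both colours: a given type and label belong either to two buds or to the two ends of
  -- one edge, so R_i records the white buds as well.
  bud-opposite : ∀ c {t i} → Bud (half (opposite c) t i) → Bud (half c t i)
  bud-opposite c {t} {i} b = decidable-stable (mate _ ≟ _) λ ¬bud →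
    mate-nonBud ¬bud (subst Bud (sym (mate-half ¬bud)) b)

  rot-black : ∀ t i → rot (half black t i) ≡ half black (next t) i
  rot-black t i = half-unique black-rot
    (trans (black-types _ (colour-half black t i)) (cong next (type-half black t i)))
    (trans (sym (label-black _ black-rot))
      (trans (blackLabel-cong (vertex-rot _) black-rot (colour-half black t i))
        (trans (label-black _ (colour-half black t i)) (label-half black t i))))
    where
    black-rot : Black (vertex (rot (half black t i)))
    black-rot = trans (cong colour (vertex-rot _)) (colour-half black t i)

  -- The label `j` is left open: this is the part of the rotation that the order ω has to settle.
  rot-white : ∀ t i → ∃ λ j → rot (half white t i) ≡ half white (prev t) j
  rot-white t i = _ , half-unique (trans (cong colour (vertex-rot _)) (colour-half white t i))
    (trans (white-types _ (colour-half white t i)) (cong prev (type-half white t i))) refl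

-- Trees and parent maps

module ParentGraph {k} (parent : Fin (suc k) → Fin (suc k)) where

  root : Fin (suc k)
  root = fromℕ k

  -- Written as in `biddingGraph`, so that for the right `parent` the two multigraphs agree by
  -- definition.
  child : Fin k → Fin (suc k)
  child s = inject≤ s (ℕ.m∸n≤m (suc k) 1)

  graph : Multigraph (suc k) k
  graph s = child s , parent (child s)

  child-injective : Injective _≡_ _≡_ child
  child-injective = Fin.inject≤-injective _ _ _ _

  child≢root : ∀ s → child s ≢ root
  child≢root s eq = ℕ.<-irrefl
    (trans (sym (Fin.toℕ-inject≤ s (ℕ.m∸n≤m (suc k) 1))) (trans (cong toℕ eq) (toℕ-fromℕ k))) (toℕ<n s)

  root-or-child : ∀ t → t ≡ root ⊎ ∃ λ s → child s ≡ t
  root-or-child t with t ≟ root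
  ... | yes eq = inj₁ eq
  ... | no  t≢ = inj₂ (fromℕ< t<k , toℕ-injective (trans (Fin.toℕ-inject≤ _ (ℕ.m∸n≤m (suc k) 1)) (toℕ-fromℕ< t<k)))
    where
    t<k : toℕ t < k
    t<k = ℕ.≤∧≢⇒< (ℕ.≤-pred (toℕ<n t)) λ eq → t≢ (toℕ-injective (trans eq (sym (toℕ-fromℕ k))))

  Connected : Fin (suc k) → Fin (suc k) → Set
  Connected x y = ∃₂ λ xs as → Walk graph x y xs as

  connected-trans : ∀ {x y z} → Connected x y → Connected y z → Connected x z
  connected-trans (_ , _ , stop)     q = q
  connected-trans (_ , _ , step j w) q with _ , _ , w′ ← connected-trans (_ , _ , w) q = _ , _ , step j w′

  connected-sym : ∀ {x y} → Connected x y → Connected y x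
  connected-sym (_ , _ , stop)     = _ , _ , stop
  connected-sym (_ , _ , step j w) =
    connected-trans (connected-sym (_ , _ , w)) (_ , _ , step (Sum.swap j) stop)

  module _ (d : Fin (suc k) → ℕ) (descends : ∀ s → d (parent (child s)) < d (child s)) where

    to-root : ∀ t → Acc _<_ (d t) → Connected t root
    to-root t (acc rs) with root-or-child t
    ... | inj₁ refl       = _ , _ , stop
    ... | inj₂ (s , refl) = connected-trans (_ , _ , step {a = s} (inj₁ refl) stop)
                              (to-root _ (rs (descends s)))

    -- A walk which repeats no edge and does not start by descending never
    -- descends, as the only way down from a child is the edge used to reach it.
    ascending : ∀ {y z xs as} → Walk graph y z xs as → Unique as → (∀ {a} → a ∈ₗ as → child a ≢ y) →
      y ≡ z ⊎ d y < d z
    ascending stop _ _ = inj₁ refl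
    ascending (step (inj₁ refl) w) _ not-down = contradiction refl (not-down (here refl))
    ascending (step {a = a} (inj₂ refl) w) uniq@(_ ∷ uniq′) _
      with ascending w uniq′ (λ a′∈ eq → Unique[x∷xs]⇒x∉xs uniq (subst (_∈ₗ _) (child-injective eq) a′∈))
    ... | inj₁ refl = inj₂ (descends a)
    ... | inj₂ lt   = inj₂ (ℕ.<-trans (descends a) lt)

    -- A walk that ends higher than it starts must rise into its endpoint, and the only edge rising
    -- into a child is the child's own. In `acyclic` this is the edge with which the closed walk
    -- began.
    descending : ∀ {y z xs as} → Walk graph y z xs as → Unique as →
      d z ≤ d y ⊎ ∃ λ a → a ∈ₗ as × child a ≡ z
    descending stop _ = inj₁ ℕ.≤-refl
    descending (step {a = a} j w) uniq@(_ ∷ uniq′) with descending w uniq′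
    descending (step j w) _ | inj₂ (a′ , a′∈ , eq) = inj₂ (a′ , there a′∈ , eq)
    descending (step {a = a} (inj₁ refl) w) _ | inj₁ le = inj₁ (ℕ.≤-trans le (ℕ.<⇒≤ (descends a)))
    descending (step {a = a} (inj₂ refl) w) uniq@(_ ∷ uniq′) | inj₁ le
      with ascending w uniq′ (λ a′∈ eq → Unique[x∷xs]⇒x∉xs uniq (subst (_∈ₗ _) (child-injective eq) a′∈))
    ... | inj₁ eq = inj₂ (a , here refl , eq)
    ... | inj₂ lt = contradiction le (ℕ.<⇒≱ lt)

    acyclic : ∀ {x xs as} → Walk graph x x xs as → Unique xs → Unique as → as ≡ []
    acyclic stop _ _ = refl
    acyclic (step {a = a} (inj₁ refl) w) _ uniq@(_ ∷ uniq′) with descending w uniq′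
    ... | inj₁ le              = contradiction le (ℕ.<⇒≱ (descends a))
    ... | inj₂ (a′ , a′∈ , eq) = contradiction (subst (_∈ₗ _) (child-injective eq) a′∈) (Unique[x∷xs]⇒x∉xs uniq)
    acyclic (step {a = a} (inj₂ refl) w) _ uniq@(_ ∷ uniq′)
      with ascending w uniq′ (λ a′∈ eq → Unique[x∷xs]⇒x∉xs uniq (subst (_∈ₗ _) (child-injective eq) a′∈))
    ... | inj₁ eq = contradiction (descends a) (ℕ.<-irrefl (sym (cong d eq)))
    ... | inj₂ lt = contradiction lt (ℕ.<-asym (descends a))

    descending⇒tree : IsTree graph
    descending⇒tree = record
      { connected = λ x y → connected-trans (to-root x (ℕ.<-wellFounded _))
                              (connected-sym (to-root y (ℕ.<-wellFounded _)))
      ; acyclic   = acyclic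
      }

  data Descendant : Fin (suc k) → Set where
    ancestor : Descendant root
    below    : ∀ s → Descendant (parent (child s)) → Descendant (child s)

  -- Along a walk from the root, an edge taken towards the parent removes one `below` and an edge
  -- taken towards the child adds one.
  tree⇒descendant : IsTree graph → ∀ t → Descendant t
  tree⇒descendant tree t with _ , _ , w ← IsTree.connected tree root t = along w ancestor
    where
    parent-descendant : ∀ {t} → Descendant t → ∀ s → child s ≡ t → Descendant (parent (child s))
    parent-descendant ancestor         s eq = contradiction eq (child≢root s)
    parent-descendant (below s′ r) s eq = subst (Descendant ∘ parent) (sym eq) r

    along : ∀ {x y xs as} → Walk graph x y xs as → Descendant x → Descendant y
    along stop r = r
    along (step {a = a} (inj₁ refl) w) r = along w (parent-descendant r a refl)
    along (step {a = a} (inj₂ refl) w) r = along w (below a r)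

-- Eulerian tours with prescribed order of exits

least : ∀ {N} (ρ : Fin N → ℕ) {P : Pred (Fin N) 0ℓ} → Decidable P → ∃ P →
  ∃ λ y → P y × ∀ z → P z → ρ y ≤ ρ z
least ρ {P} P? (y , py) = go y py (ℕ.<-wellFounded (ρ y))
  where
  go : ∀ y → P y → Acc _<_ (ρ y) → ∃ λ y → P y × ∀ z → P z → ρ y ≤ ρ z
  go y py (acc rs) with any? (λ z → P? z ×-dec (ρ z ℕ.<? ρ y))
  ... | yes (z , pz , lt) = go z pz (rs lt)
  ... | no none = y , py , λ z pz → ℕ.≮⇒≥ λ lt → none (z , pz , lt)

-- The arcs of a digraph with vertex set Q are Fin N.  It is balanced, which
-- is expressed by τ: the head of the arc a is the tail of τ a.  The arcs
-- leaving a vertex are taken in increasing order of ρ, except that the tour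
-- starts with s, the last one at its tail.

module Tour {N} {Q : Set} (_≟Q_ : DecidableEquality Q) (tail : Fin N → Q) (τ : Permutation′ N)
            (ρ : Fin N → ℕ) (s : Fin N) (s-max : ∀ a → tail a ≡ tail s → ρ a ≤ ρ s) where

  head : Fin N → Q
  head a = tail (τ ⟨$⟩ʳ a)

  -- Only the values of `x` up to `m` count. `greedy` constrains x 1, ..., x m; the first arc `s` is
  -- excepted, being the last exit at its tail.
  record Trail (m : ℕ) : Set where
    field
      x      : ℕ → Fin N
      start  : x 0 ≡ s
      simple : ∀ {i j} → i ≤ m → j ≤ m → x i ≡ x j → i ≡ j
      linked : ∀ {j} → j < m → tail (x (suc j)) ≡ head (x j)
      greedy : ∀ {j} → j < m → ∀ z → tail z ≡ tail (x (suc j)) → ρ z < ρ (x (suc j)) →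
               ∃ λ i → i < suc j × x i ≡ z

    Used : Fin N → Set
    Used z = ∃ λ i → i < suc m × x i ≡ z

    used? : Decidable Used
    used? z = ℕ.anyUpTo? (λ i → x i ≟ z) (suc m)

    length<N : m < N
    length<N = injective⇒≤ {f = λ (i : Fin (suc m)) → x (toℕ i)}
      λ {i} {j} eq → toℕ-injective (simple (ℕ.≤-pred (toℕ<n i)) (ℕ.≤-pred (toℕ<n j)) eq)

  module _ {m} (T : Trail m) (y : Fin N) where
    open Trail T

    private
      x′ : ℕ → Fin N
      x′ i with i ℕ.≤? m
      ... | yes _ = x i
      ... | no  _ = y

      x′-old : ∀ {i} → i ≤ m → x′ i ≡ x i
      x′-old {i} i≤m with i ℕ.≤? m
      ... | yes _  = refl
      ... | no i≰m = contradiction i≤m i≰m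

      x′-new : x′ (suc m) ≡ y
      x′-new with suc m ℕ.≤? m
      ... | yes m<m = contradiction m<m (ℕ.<-irrefl refl)
      ... | no  _   = refl

    extend : ¬ Used y → tail y ≡ head (x m) →
      (∀ z → ¬ Used z × tail z ≡ head (x m) → ρ y ≤ ρ z) → Trail (suc m)
    extend unused follows min = record
      { x = x′ ; start = trans (x′-old z≤n) start ; simple = simple′ ; linked = linked′ ; greedy = greedy′ }
      where
      simple′ : ∀ {i j} → i ≤ suc m → j ≤ suc m → x′ i ≡ x′ j → i ≡ j
      simple′ {i} {j} i≤ j≤ eq with ℕ.m≤n⇒m<n∨m≡n i≤ | ℕ.m≤n⇒m<n∨m≡n j≤
      ... | inj₁ (s≤s i≤m) | inj₁ (s≤s j≤m) = simple i≤m j≤m (trans (sym (x′-old i≤m)) (trans eq (x′-old j≤m)))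
      ... | inj₁ (s≤s i≤m) | inj₂ refl =
        contradiction (i , s≤s i≤m , trans (sym (x′-old i≤m)) (trans eq x′-new)) unused
      ... | inj₂ refl | inj₁ (s≤s j≤m) =
        contradiction (j , s≤s j≤m , trans (sym (x′-old j≤m)) (trans (sym eq) x′-new)) unused
      ... | inj₂ refl | inj₂ refl = refl

      linked′ : ∀ {j} → j < suc m → tail (x′ (suc j)) ≡ head (x′ j)
      linked′ {j} j< with ℕ.m≤n⇒m<n∨m≡n (ℕ.≤-pred j<)
      ... | inj₁ j<m  = trans (cong tail (x′-old j<m)) (trans (linked j<m) (cong head (sym (x′-old (ℕ.<⇒≤ j<m)))))
      ... | inj₂ refl = trans (cong tail x′-new) (trans follows (cong head (sym (x′-old ℕ.≤-refl))))

      old : ∀ {j z} → j ≤ m → (∃ λ i → i < suc j × x i ≡ z) → ∃ λ i → i < suc j × x′ i ≡ z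
      old j≤m (i , i< , eq) = i , i< , trans (x′-old (ℕ.≤-trans (ℕ.≤-pred i<) j≤m)) eq

      greedy′ : ∀ {j} → j < suc m → ∀ z → tail z ≡ tail (x′ (suc j)) → ρ z < ρ (x′ (suc j)) →
                ∃ λ i → i < suc j × x′ i ≡ z
      greedy′ {j} j< z tt lt with ℕ.m≤n⇒m<n∨m≡n (ℕ.≤-pred j<)
      ... | inj₁ j<m  = old (ℕ.<⇒≤ j<m)
        (greedy j<m z (trans tt (cong tail (x′-old j<m))) (subst (λ a → ρ z < ρ a) (x′-old j<m) lt))
      ... | inj₂ refl = old ℕ.≤-refl (decidable-stable (used? z) λ ¬used →
        contradiction (min z (¬used , trans tt (trans (cong tail x′-new) follows)))
          (ℕ.<⇒≱ (subst (λ a → ρ z < ρ a) x′-new lt)))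

  Stuck : ∀ {m} → Trail m → Set
  Stuck {m} T = ∀ y → tail y ≡ head (x m) → Used y
    where open Trail T

  opaque
    maximal : ∃ λ m → Σ (Trail m) Stuck
    maximal = go N 0 trivial (ℕ.m≤m+n N 0)
      where
      trivial : Trail 0
      trivial = record
        { x = λ _ → s ; start = refl ; simple = λ { z≤n z≤n _ → refl } ; linked = λ () ; greedy = λ () }

      -- A trail of index `m` has m + 1 distinct arcs, so the fuel cannot run out while
      -- `N ≤ fuel + m` holds.
      go : ∀ fuel m → Trail m → N ≤ fuel + m → ∃ λ m → Σ (Trail m) Stuck
      go zero m T N≤ = contradiction N≤ (ℕ.<⇒≱ (Trail.length<N T))
      go (suc fuel) m T N≤
        with any? (λ y → ¬? (Trail.used? T y) ×-dec (tail y ≟Q head (Trail.x T m)))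
      ... | no none = m , T , λ y eq → decidable-stable (Trail.used? T y) λ unused → none (y , unused , eq)
      ... | yes (y₀ , unused₀ , eq₀)
        with y , (unused , eq) , min ← least ρ (λ y → ¬? (Trail.used? T y) ×-dec (tail y ≟Q head (Trail.x T m)))
                                         (y₀ , unused₀ , eq₀)
        = go fuel (suc m) (extend T y unused eq min) (subst (N ≤_) (sym (ℕ.+-suc fuel m)) N≤)

  module _ {m} (T : Trail m) (stuck : Stuck T) where
    open Trail T

    private
      -- Treats the trail as cyclic: the first arc is preceded by the last one.
      before : ℕ → ℕ
      before zero    = m
      before (suc i) = i

      before≤ : ∀ {i} → i ≤ m → before i ≤ m
      before≤ {zero}  _ = ℕ.≤-refl
      before≤ {suc i}   = ℕ.<⇒≤

      before-injective : ∀ {i j} → i ≤ m → j ≤ m → before i ≡ before j → i ≡ j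
      before-injective {zero}  {zero}  _ _ _ = refl
      before-injective {zero}  {suc j} _ j≤ refl = contradiction j≤ (ℕ.<-irrefl refl)
      before-injective {suc i} {zero}  i≤ _ refl = contradiction i≤ (ℕ.<-irrefl refl)
      before-injective {suc i} {suc j} _ _ refl = refl

    -- Sending an exit a of u to τ of the arc by which the trail entered u
    -- before taking a is an injection of the exits of u into themselves, so
    -- it reaches τ b for every arc b into u.
    entered-by : ∀ u → (∀ a → tail a ≡ u → Used a) → (tail s ≡ u → head (x m) ≡ u) →
      ∀ b → head b ≡ u → ∃ λ i → i ≤ m × tail (x i) ≡ u × x (before i) ≡ b
    entered-by u all closed b hb = result
      where
      enter : ∀ {a} → Used a → Fin N
      enter (i , _) = τ ⟨$⟩ʳ x (before i)

      g : Fin N → Fin N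
      g a with tail a ≟Q u
      ... | yes eq = enter (all a eq)
      ... | no  _  = a

      tail-enter : ∀ {a} (used : Used a) → tail a ≡ u → tail (enter used) ≡ u
      tail-enter (zero  , _  , eq) tt = closed (trans (cong tail (trans (sym start) eq)) tt)
      tail-enter (suc i , i< , eq) tt = trans (sym (linked (ℕ.≤-pred i<))) (trans (cong tail eq) tt)

      enter-injective : ∀ {a a′} (used : Used a) (used′ : Used a′) → enter used ≡ enter used′ → a ≡ a′
      enter-injective (i , i< , refl) (j , j< , refl) eq = cong x (before-injective (ℕ.≤-pred i<) (ℕ.≤-pred j<)
        (simple (before≤ (ℕ.≤-pred i<)) (before≤ (ℕ.≤-pred j<)) (⟨$⟩ʳ-injective τ eq)))

      g-injective : Injective _≡_ _≡_ g
      g-injective {a} {a′} eq with tail a ≟Q u | tail a′ ≟Q u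
      ... | yes p | yes q = enter-injective (all a p) (all a′ q) eq
      ... | yes p | no ¬q = contradiction (trans (cong tail (sym eq)) (tail-enter (all a p) p)) ¬q
      ... | no ¬p | yes q = contradiction (trans (cong tail eq) (tail-enter (all a′ q) q)) ¬p
      ... | no ¬p | no ¬q = eq

      result : ∃ λ i → i ≤ m × tail (x i) ≡ u × x (before i) ≡ b
      result with injective⇒surjective g-injective ℕ.≤-refl (τ ⟨$⟩ʳ b)
      ... | a , eq with tail a ≟Q u
      ...   | no ¬p = contradiction (trans (cong tail eq) hb) ¬p
      ...   | yes p with all a p
      ...     | i , i< , refl = i , ℕ.≤-pred i< , p , ⟨$⟩ʳ-injective τ eq

    -- If the trail got stuck at another vertex, all exits there would be used, and by `entered-by`
    -- the final arc would be followed by one of them. Then the arc `x m` would also occur at an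
    -- earlier index.
    closed : head (x m) ≡ tail s
    closed with head (x m) ≟Q tail s
    ... | yes eq = eq
    ... | no ¬eq with entered-by (head (x m)) stuck (λ eq → contradiction (sym eq) ¬eq) (x m) refl
    ...   | zero  , _   , tt , _  = trans (sym tt) (cong tail start)
    ...   | suc i , i<m , _  , eq = contradiction (simple (ℕ.<⇒≤ i<m) ℕ.≤-refl eq) (ℕ.<⇒≢ i<m)

    exits⇒entries : ∀ u → (∀ a → tail a ≡ u → Used a) → ∀ b → head b ≡ u → Used b
    exits⇒entries u all b hb with i , i≤m , _ , eq ← entered-by u all (trans closed) b hb =
      before i , s≤s (before≤ i≤m) , eq

    -- Once `b` is known to be used, greed shows that the exits ranked below `b` at the same tail
    -- were taken before it.
    propagate : ∀ b → (∀ a → tail a ≡ head b → Used a) →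
      ∀ c → tail c ≡ tail b → c ≡ b ⊎ ρ c < ρ b → Used c
    propagate b all c tt (inj₁ refl) = exits⇒entries (head b) all b refl
    propagate b all c tt (inj₂ lt) with exits⇒entries (head b) all b refl
    -- Here `b` is `s`, to which `greedy` does not apply; but the trail ends at the tail of `s` and
    -- is stuck there.
    ... | zero  , _  , refl = stuck c (trans tt (trans (cong tail start) (sym closed)))
    ... | suc j , j< , refl with i , i< , eq ← greedy (ℕ.≤-pred j<) c tt lt = i , ℕ.<-trans i< j< , eq

    module _ (all : ∀ a → Used a) where

      private
        length≡N : suc m ≡ N
        length≡N = ℕ.≤-antisym length<N (injective⇒≤ {f = λ a → fromℕ< (proj₁ (proj₂ (all a)))} λ {a} {b} eq →
          trans (sym (proj₂ (proj₂ (all a))))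
            (trans (cong x (trans (sym (toℕ-fromℕ< _)) (trans (cong toℕ eq) (toℕ-fromℕ< _))))
              (proj₂ (proj₂ (all b)))))

        after : ∀ i → Dec (i < m) → ℕ
        after i (yes _) = suc i
        after i (no _)  = 0

      turnBy : Fin N → Fin N
      turnBy a = x (after (proj₁ (all a)) (proj₁ (all a) ℕ.<? m))

      private
        index : ∀ {i} → i ≤ m → proj₁ (all (x i)) ≡ i
        index {i} i≤m = simple (ℕ.≤-pred (proj₁ (proj₂ (all (x i))))) i≤m (proj₂ (proj₂ (all (x i))))

        turn-x : ∀ {i} → i < m → turnBy (x i) ≡ x (suc i)
        turn-x {i} i<m = trans (cong (λ j → x (after j (j ℕ.<? m))) (index (ℕ.<⇒≤ i<m))) lemma
          where
          lemma : x (after i (i ℕ.<? m)) ≡ x (suc i)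
          lemma with i ℕ.<? m
          ... | yes _ = refl
          ... | no i≮ = contradiction i<m i≮

        turn-last : turnBy (x m) ≡ x 0
        turn-last = trans (cong (λ j → x (after j (j ℕ.<? m))) (index ℕ.≤-refl)) lemma
          where
          lemma : x (after m (m ℕ.<? m)) ≡ x 0
          lemma with m ℕ.<? m
          ... | yes m<m = contradiction m<m (ℕ.<-irrefl refl)
          ... | no _    = refl

        fold-x : ∀ {i} d → d + i ≤ m → fold (x i) turnBy d ≡ x (d + i)
        fold-x zero    _  = refl
        fold-x (suc d) le = trans (cong turnBy (fold-x d (ℕ.<⇒≤ le))) (turn-x le)

        fold-start : ∀ {j} → j ≤ m → fold s turnBy j ≡ x j
        fold-start {j} j≤m = trans (cong (λ a → fold a turnBy j) (sym start))
          (trans (fold-x j (subst (_≤ m) (sym (ℕ.+-identityʳ j)) j≤m)) (cong x (ℕ.+-identityʳ j)))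

        to-start : ∀ {i} → i ≤ m → fold (x i) turnBy (suc (m ∸ i)) ≡ s
        to-start {i} i≤m = trans (cong turnBy (trans (fold-x (m ∸ i) (ℕ.≤-reflexive (ℕ.m∸n+n≡m i≤m)))
          (cong x (ℕ.m∸n+n≡m i≤m)))) (trans turn-last start)

      turnBy-linked : ∀ a → tail (turnBy a) ≡ head a
      turnBy-linked a with all a
      ... | i , i< , refl with i ℕ.<? m
      ...   | yes i<m = linked i<m
      ...   | no  i≮m with refl ← ℕ.≤-antisym (ℕ.≤-pred i<) (ℕ.≮⇒≥ i≮m) = trans (cong tail start) (sym closed)

      turnBy-transitive : ∀ a b → ∃ λ d → fold a turnBy d ≡ b
      turnBy-transitive a b with all a | all b
      ... | i , i< , refl | j , j< , refl = j + suc (m ∸ i) , trans (fold-+ (x i) turnBy j)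
        (trans (cong (λ a → fold a turnBy j) (to-start (ℕ.≤-pred i<))) (fold-start (ℕ.≤-pred j<)))

      turnBy-order : ∀ a b → tail a ≡ tail b → ρ a < ρ b →
        ∃₂ λ i j → 1 ≤ i × i < j × j ≤ N × fold s turnBy i ≡ a × fold s turnBy j ≡ b
      turnBy-order a b tt lt with all a | all b
      -- `a` cannot be `s`, which has the greatest rank at its tail.
      ... | zero , _ , refl | _ =
        contradiction lt (ℕ.≤⇒≯ (subst (λ a → ρ b ≤ ρ a) (sym start) (s-max b (trans (sym tt) (cong tail start)))))
      -- Here `b` is `s`; it is counted at time N, when the tour closes up, and not at time 0.
      ... | suc i , i< , eqa | zero , _ , refl = suc i , suc m , s≤s z≤n , i< , ℕ.≤-reflexive length≡N ,
        trans (fold-start (ℕ.≤-pred i<)) eqa ,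
        trans (cong (λ a → fold a turnBy (suc m)) (sym start)) (trans (to-start z≤n) (sym start))
      ... | suc i , i< , eqa | suc j , j< , refl with greedy (ℕ.≤-pred j<) a tt lt
      ...   | i′ , i′< , eq = i′ , suc j , 1≤i′ , i′< , ℕ.≤-trans (ℕ.<⇒≤ j<) (ℕ.≤-reflexive length≡N) ,
        trans (fold-start (ℕ.≤-pred (ℕ.<-trans i′< j<))) eq , fold-start (ℕ.≤-pred j<)
        where
        -- `greedy` alone would allow index 0, but `a` already sits at the positive index `suc i`
        -- and the trail is simple.
        1≤i′ : 1 ≤ i′
        1≤i′ = subst (1 ≤_) (simple (ℕ.≤-pred i<) (ℕ.≤-pred (ℕ.<-trans i′< j<)) (trans eqa (sym eq))) (s≤s z≤n)

-- The bidding of a nebula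

α-∈ : ∀ {t : Fin k} {R} → t ∈ R → α t R ≡ prev t
α-∈ {t = t} {R} t∈R with t ∈? R
... | yes _   = refl
... | no  t∉R = contradiction t∈R t∉R

opaque
  subset : {P : Pred (Fin m) 0ℓ} → Decidable P → Subset m
  subset P? = Vec.tabulate (does ∘ P?)

  ∈-subset⇔ : {P : Pred (Fin m) 0ℓ} (P? : Decidable P) → ∀ x → x ∈ subset P? ⇔ P x
  ∈-subset⇔ {P = P} P? x = mk⇔
    (λ x∈ → decided (trans (sym (lookup∘tabulate (does ∘ P?) x)) ([]=⇒lookup x∈)))
    (λ px → lookup⇒[]= x _ (trans (lookup∘tabulate (does ∘ P?) x) (dec-true (P? x) px)))
    where
    decided : does (P? x) ≡ true → P x
    decided eq with P? x
    ... | yes px = px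

module Positions {k n} {p : Fin (suc k) → ℕ} (N : LabelledRootedNebula (suc k) n p) where
  open Frame N public

  rootLabel : Fin n
  rootLabel = blackLabel root root-black

  start : H
  start = half white (fromℕ k) rootLabel

  open Cyclic turn single-face start public

  -- `Precedes` quantifies over its starting corner; uniqueness of coordinates forces this to be
  -- `start`, and then the two times are values of `pos`.
  precedes⇒< : ∀ {t i u j} → Precedes (t , i) (u , j) → pos (half white t i) < pos (half white u j)
  precedes⇒< {t} {i} {u} {j} (s , os , a , b , 1≤a , a<b , b≤H , oa , ob) with refl ← object⇒half os =
    subst (λ h → pos h < pos (half white u j)) (object⇒half oa)
      (subst (λ h → pos (fold s turn a) < pos h) (object⇒half ob)
        (subst (_< pos (fold s turn b)) (sym (pos-fold 1≤a (ℕ.≤-trans (ℕ.<⇒≤ a<b) b≤H)))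
          (subst (a <_) (sym (pos-fold (ℕ.≤-trans 1≤a (ℕ.<⇒≤ a<b)) b≤H)) a<b)))

  <⇒precedes : ∀ {t i u j} → pos (half white t i) < pos (half white u j) → Precedes (t , i) (u , j)
  <⇒precedes {t} {i} {u} {j} lt = start , half-object _ _ , pos (half white t i) , pos (half white u j) ,
    1≤pos _ , lt , pos≤N _ ,
    subst (Object t i) (sym (fold-pos _)) (half-object t i) ,
    subst (Object u j) (sym (fold-pos _)) (half-object u j)

  half-injective : ∀ c t {i j} → half c t i ≡ half c t j → i ≡ j
  half-injective c t {i} {j} eq = trans (sym (label-half c t i)) (trans (cong label eq) (label-half c t j))

  black≢start : ∀ {t i} → half black t i ≢ start
  black≢start eq = white≢black (colour-half white (fromℕ k) rootLabel)
    (trans (cong colourOf (sym eq)) (colour-half black _ _))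

  turn-bud : ∀ {h} → Bud h → turn h ≡ rot h
  turn-bud = cong rot

  turn-edge : ∀ {c t i} → ¬ Bud (half c t i) → turn (half c t i) ≡ rot (half (opposite c) t i)
  turn-edge ¬bud = cong rot (mate-half ¬bud)

  -- The walk from the white corner (t , i) crosses the black buds of label i
  -- and types t + 1, …, t + r before it returns to a white vertex.
  module _ (i : Fin n) (R : Subset (suc k)) (∈R⇔bud : ∀ t → t ∈ R ⇔ Bud (half black t i)) where

    private
      black-run : ∀ t r → (∀ j → 1 ≤ j → j ≤ r → fold t next j ∈ R) →
        pos (half black (fold t next (suc r)) i) ≡ r + pos (half black (next t) i)
      black-run t zero    _   = refl
      black-run t (suc r) all = begin
        pos (half black (next (fold t next (suc r))) i)
          ≡⟨ cong pos (sym (trans (turn-bud (Equivalence.to (∈R⇔bud _) (all (suc r) (s≤s z≤n) ℕ.≤-refl))) (rot-black _ i))) ⟩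
        pos (turn (half black (fold t next (suc r)) i))
          ≡⟨ pos-step black≢start ⟩
        suc (pos (half black (fold t next (suc r)) i))
          ≡⟨ cong suc (black-run t r λ j 1≤j j≤r → all j 1≤j (ℕ.m≤n⇒m≤1+n j≤r)) ⟩
        suc (r + pos (half black (next t) i)) ∎
        where open ≡-Reasoning

    next-white : ∀ t → half white t i ≢ start →
      ∃ λ j → pos (half white t i) < pos (half white (α t R) j)
    next-white t ≢start = by-cases (t ∈? R)
      where
      by-cases : Dec (t ∈ R) → ∃ λ j → pos (half white t i) < pos (half white (α t R) j)
      by-cases (yes t∈R) with j , rot≡ ← rot-white t i = j , subst (λ u → pos (half white t i) < pos (half white u j))
        (sym (α-∈ t∈R)) (ℕ.≤-reflexive (trans (sym (pos-step ≢start))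
          (cong pos (trans (turn-bud (bud-opposite white (Equivalence.to (∈R⇔bud t) t∈R))) rot≡))))
      by-cases (no t∉R) with r , all , ∉R , α≡ ← α-∉ t R t∉R
                        with j , rot≡ ← rot-white (fold t next (suc r)) i = j ,
        subst (λ u → pos (half white t i) < pos (half white u j)) (trans (prev-next _) (sym α≡))
          (subst (pos (half white t i) <_) pos≡ (s≤s (ℕ.≤-trans (ℕ.n≤1+n _) (ℕ.m≤n+m _ r))))
        where
        -- One step leads to the black half-edge of type t + 1, r steps cross the buds, and one more
        -- follows the edge of type t + r + 1 back to a white corner of type t + r.
        pos≡ : suc (r + suc (pos (half white t i))) ≡ pos (half white (prev (fold t next (suc r))) j)
        pos≡ = begin
          suc (r + suc (pos (half white t i)))
            ≡⟨ cong (λ x → suc (r + x)) (trans (sym (pos-step ≢start)) (cong pos (trans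
                 (turn-edge (t∉R ∘ Equivalence.from (∈R⇔bud t) ∘ bud-opposite black)) (rot-black t i)))) ⟩
          suc (r + pos (half black (next t) i))
            ≡⟨ cong suc (sym (black-run t r all)) ⟩
          suc (pos (half black (fold t next (suc r)) i))
            ≡⟨ sym (pos-step black≢start) ⟩
          pos (turn (half black (fold t next (suc r)) i))
            ≡⟨ cong pos (trans (turn-edge (∉R ∘ Equivalence.from (∈R⇔bud _))) rot≡) ⟩
          pos (half white (prev (fold t next (suc r))) j) ∎
          where open ≡-Reasoning

  module Image (p-positive : ∀ t → 1 ≤ p t) where

    R : Fin n → Subset (suc k)
    R i = subset λ t → mate (half black t i) ≟ half black t i

    ∈R⇔bud : ∀ i t → t ∈ R i ⇔ Bud (half black t i)
    ∈R⇔bud i t = ∈-subset⇔ (λ t → mate (half black t i) ≟ half black t i) t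

    private
      whiteVertex : ∃ White
      whiteVertex with h , (_ , w) , _ ← count⇒∃ (λ h → ((mate h ≟ h) ×-dec (colour (vertex h) ≟ᶜ white)) ×-dec (type h ≟ zero))
                         (subst (1 ≤_) (trans (sym (bud-type zero)) (balanced zero)) (p-positive zero)) = _ , w

      edgeFrom : ∀ {v w} → Black v → White w → Star Adjacent v w → ∃ λ h → vertex h ≡ v × ¬ Bud h
      edgeFrom b w ε = contradiction b (white≢black w)
      edgeFrom b w ((h , hv , mv) ◅ path) with mate h ≟ h
      ... | no ¬bud = h , hv , ¬bud
      ... | yes eq with refl ← trans (sym hv) (trans (cong vertex (sym eq)) mv) = edgeFrom b w path

    -- Positivity of `p zero` yields a white bud, hence a white vertex, and the path to it from the
    -- black vertex labelled `i` has to leave along an edge. This gives the strictness of `R i`.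
    edgeLabelled : ∀ i → ∃ λ t → ¬ Bud (half black t i)
    edgeLabelled i with edgeFrom (colour-half black zero i) (proj₂ whiteVertex) (connected _ _)
    ... | h , hv , ¬bud = type h , subst (¬_ ∘ Bud) (half-unique h-black refl
      (trans (sym (label-black h h-black)) (trans (blackLabel-cong hv h-black (colour-half black zero i))
        (trans (label-black (half black zero i) (colour-half black zero i)) (label-half black zero i))))) ¬bud
      where
      h-black = trans (cong colour hv) (colour-half black zero i)

    sorted : ∀ t → ∃ λ (π : Permutation′ n) → Increasing (λ i → pos (half white t (π ⟨$⟩ʳ i)))
    sorted t = sort (λ i → pos (half white t i)) (λ eq → half-injective white t (pos-injective eq))

    bidding : Bidding (suc k) n p
    bidding = record
      { ω = proj₁ ∘ sorted
      ; R = R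
      ; R-strict = λ i → let t , ¬bud = edgeLabelled i in ⊆⊤ , t , ∈⊤ , ¬bud ∘ Equivalence.to (∈R⇔bud i t)
      ; R-type = λ t → trans
          (count-≡ (λ i → t ∈? R i) (λ h → ((mate h ≟ h) ×-dec (colour (vertex h) ≟ᶜ black)) ×-dec (type h ≟ t))
            (half black t) label
            (λ i t∈R → (Equivalence.to (∈R⇔bud i t) t∈R , colour-half black t i) , type-half black t i)
            (λ h ((m , b) , tt) → Equivalence.from (∈R⇔bud (label h) t) (subst Bud (half-unique b tt refl) m))
            (λ i _ → label-half black t i)
            (λ h ((m , b) , tt) → sym (half-unique b tt refl)))
          (bud-type t)
      }

    Ψ-bidding : Ψ[ N ]≡ bidding
    Ψ-bidding = record
      { R-types = λ i t → mk⇔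
          (λ t∈R → half black t i , (Equivalence.to (∈R⇔bud i t) t∈R , colour-half black t i) ,
            type-half black t i , trans (label-black _ (colour-half black t i)) (label-half black t i))
          (λ (h , (m , b) , tt , ll) → Equivalence.from (∈R⇔bud i t)
            (subst Bud (half-unique b tt (trans (sym (label-black h b)) ll)) m))
      ; ω-order = λ t a b a<b → <⇒precedes (proj₂ (sorted t) a b a<b)
      }

Ψ-resp-≈ : {p : Fin (suc k) → ℕ} {N : LabelledRootedNebula (suc k) n p} {B B′ : Bidding (suc k) n p} →
  Setoid._≈_ (Biddings (suc k) n p) B B′ → Ψ[ N ]≡ B → Ψ[ N ]≡ B′
Ψ-resp-≈ {N = N} {B} {B′} (ω≈ , R≈) ψ = record
  { R-types = λ i t → mk⇔ (Equivalence.to (ψ.R-types i t) ∘ subst (t ∈_) (sym (R≈ i)))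
                          (subst (t ∈_) (R≈ i) ∘ Equivalence.from (ψ.R-types i t))
  ; ω-order = λ t a b a<b → subst (λ i → Precedes (t , i) (t , B′.ω t ⟨$⟩ʳ b)) (ω≈ t a)
      (subst (λ i → Precedes (t , B.ω t ⟨$⟩ʳ a) (t , i)) (ω≈ t b) (ψ.ω-order t a b a<b))
  }
  where
  module ψ = Ψ[_]≡_ ψ
  module B = Bidding B
  module B′ = Bidding B′
  open LabelledRootedNebula N using (Precedes)

module _ {k n} {p : Fin (suc k) → ℕ} {N : LabelledRootedNebula (suc k) n p} where
  open Positions N

  Ψ-increasing : ∀ {B} → Ψ[ N ]≡ B → ∀ t → Increasing (λ i → pos (half white t (Bidding.ω B t ⟨$⟩ʳ i)))
  Ψ-increasing ψ t i j i<j = precedes⇒< (Ψ[_]≡_.ω-order ψ t i j i<j)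

  Ψ-unique : ∀ {B B′} → Ψ[ N ]≡ B → Ψ[ N ]≡ B′ → Setoid._≈_ (Biddings (suc k) n p) B B′
  Ψ-unique {B} {B′} ψ ψ′ =
    (λ t → increasing-unique (λ i → pos (half white t i)) (Bidding.ω B t) (Bidding.ω B′ t)
             (Ψ-increasing ψ t) (Ψ-increasing ψ′ t)) ,
    (λ i → ⊆-antisym
      (λ {t} → Equivalence.from (Ψ[_]≡_.R-types ψ′ i t) ∘ Equivalence.to (Ψ[_]≡_.R-types ψ i t))
      (λ {t} → Equivalence.from (Ψ[_]≡_.R-types ψ i t) ∘ Equivalence.to (Ψ[_]≡_.R-types ψ′ i t)))

  Ψ-∈⇔bud : ∀ {B} → Ψ[ N ]≡ B → ∀ i t → t ∈ Bidding.R B i ⇔ Bud (half black t i)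
  Ψ-∈⇔bud ψ i t = mk⇔
    (λ t∈R → case Equivalence.to (R-types i t) t∈R of λ (h , (m , b) , tt , ll) →
      subst Bud (half-unique b tt (trans (sym (label-black h b)) ll)) m)
    (λ m → Equivalence.from (R-types i t)
      (half black t i , (m , colour-half black t i) , type-half black t i ,
        trans (label-black _ (colour-half black t i)) (label-half black t i)))
    where open Ψ[_]≡_ ψ

-- The last exits from the types t ≠ k point forward along the tour.
Ψ-valid : {p : Fin (suc k) → ℕ} {N : LabelledRootedNebula (suc k) (suc n) p} {B : Bidding (suc k) (suc n) p} →
  Ψ[ N ]≡ B → Valid B
Ψ-valid {k} {n} {N = N} {B} ψ = G.descending⇒tree (λ t → #H ∸ last t) λ s →
  ℕ.∸-monoʳ-< (later (G.child s) (G.child≢root s)) (pos≤N _)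
  where
  open Positions N
  open Bidding B

  parent : Fin (suc k) → Fin (suc k)
  parent t = α t (R (ω t ⟨$⟩ʳ fromℕ n))

  module G = ParentGraph parent

  last : Fin (suc k) → ℕ
  last t = pos (half white t (ω t ⟨$⟩ʳ fromℕ n))

  ≤last : ∀ t i → pos (half white t i) ≤ last t
  ≤last t i with Fin.<-cmp (ω t ⟨$⟩ˡ i) (fromℕ n)
  ... | tri< lt _ _ = ℕ.<⇒≤ (subst (λ j → pos (half white t j) < last t) (inverseʳ (ω t))
                        (Ψ-increasing {N = N} ψ t _ _ lt))
  ... | tri≈ _ eq _ = ℕ.≤-reflexive (cong (pos ∘ half white t) (trans (sym (inverseʳ (ω t))) (cong (ω t ⟨$⟩ʳ_) eq)))
  ... | tri> _ _ gt = contradiction gt (ℕ.≤⇒≯ (Fin.≤fromℕ _))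

  -- The tour continues from the last exit of `t` to a white corner of type `parent t`, which is no
  -- later than the last exit there. Type k is excluded because its last exit is `start`, after
  -- which the tour begins anew.
  later : ∀ t → t ≢ fromℕ k → last t < last (parent t)
  later t t≢root = case next-white i (R i) (Ψ-∈⇔bud {N = N} ψ i) t not-start of λ (j , lt) →
    ℕ.<-≤-trans lt (≤last _ j)
    where
    i = ω t ⟨$⟩ʳ fromℕ n

    not-start : half white t i ≢ start
    not-start eq =
      t≢root (trans (sym (type-half white t i)) (trans (cong type eq) (type-half white _ rootLabel)))

-- Ψ is constant on isomorphism classes

module _ {k n} {p : Fin (suc k) → ℕ} {N N′ : LabelledRootedNebula (suc k) n p} where
  private
    module N  = Frame N
    module N′ = Frame N′

  module _ (F : Isomorphic N N′) where
    open Isomorphic F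

    private
      φ = onH ⟨$⟩ʳ_

    colour-image : ∀ h → N′.colourOf (φ h) ≡ N.colourOf h
    colour-image h = trans (cong N′.colour (vertex-≅ h)) (colour-≅ _)

    bud-image : ∀ {h} → N.Bud h → N′.Bud (φ h)
    bud-image b = trans (mate-≅ _) (cong φ b)

    label-image : ∀ h (b : N.Black (N.vertex h)) (b′ : N′.Black (N′.vertex (φ h))) →
      N′.blackLabel (N′.vertex (φ h)) b′ ≡ N.blackLabel (N.vertex h) b
    label-image h b b′ = trans (N′.blackLabel-cong (vertex-≅ h) b′ b″) (blackLabel-≅ _ b b″)
      where b″ = trans (colour-≅ _) b

    object-image : ∀ {t i w} → N.Object t i w → N′.Object t i (φ w)
    object-image {w = w} (N.edge w-white b tt ll) = N′.edge (trans (colour-image w) w-white) b′ (trans (type-≅ w) tt)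
      (trans (N′.blackLabel-cong (cong N′.vertex (mate-≅ w)) b′ b″) (trans (label-image (N.mate w) b b″) ll))
      where
      b″ = trans (colour-image (N.mate w)) b
      b′ = trans (cong N′.colourOf (mate-≅ w)) b″
    object-image {w = w} (N.bud b@(m , w-white) tt ll) =
      N′.bud b′ (trans (type-≅ w) tt) (trans (budLabel-≅ w b b′) ll)
      where b′ = bud-image m , trans (colour-image w) w-white

    fold-image : ∀ h m → φ (fold h N.turn m) ≡ fold (φ h) N′.turn m
    fold-image h zero    = refl
    fold-image h (suc m) = trans (sym (rot-≅ _)) (cong N′.rot
      (trans (sym (mate-≅ _)) (cong N′.mate (fold-image h m))))

    rootLabel-image : N′.blackLabel N′.root N′.root-black ≡ N.blackLabel N.root N.root-black
    rootLabel-image = trans (N′.blackLabel-cong root-≅ N′.root-black image-black) (blackLabel-≅ _ N.root-black image-black)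
      where image-black = trans (colour-≅ N.root) N.root-black

    precedes-image : ∀ {x y} → N.Precedes x y → N′.Precedes x y
    precedes-image {t , i} {u , j} (s , os , a , b , 1≤a , a<b , b≤ , oa , ob) =
      φ s , subst (λ i → N′.Object (fromℕ k) i (φ s)) (sym rootLabel-image) (object-image os) ,
      a , b , 1≤a , a<b , ℕ.≤-trans b≤ (injective⇒≤ (⟨$⟩ʳ-injective onH)) ,
      subst (N′.Object t i) (fold-image s a) (object-image oa) ,
      subst (N′.Object u j) (fold-image s b) (object-image ob)

    blackBud-image : ∀ {i t} →
      (∃ λ h → Σ (N.BlackBud h) λ b → N.type h ≡ t × N.blackLabel (N.vertex h) (proj₂ b) ≡ i) →
      (∃ λ h → Σ (N′.BlackBud h) λ b → N′.type h ≡ t × N′.blackLabel (N′.vertex h) (proj₂ b) ≡ i)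
    blackBud-image (h , (m , b) , tt , ll) = φ h , (bud-image m , b′) , trans (type-≅ h) tt ,
      trans (label-image h b b′) ll
      where b′ = trans (colour-image h) b

Ψ-resp-≅ : {p : Fin (suc k) → ℕ} {N N′ : LabelledRootedNebula (suc k) n p} {B : Bidding (suc k) n p} →
  Isomorphic N N′ → Ψ[ N ]≡ B → Ψ[ N′ ]≡ B
Ψ-resp-≅ F ψ = record
  { R-types = λ i t → mk⇔ (blackBud-image F ∘ Equivalence.to (R-types i t))
                          (Equivalence.from (R-types i t) ∘ blackBud-image (Isomorphic-sym F))
  ; ω-order = λ t a b a<b → precedes-image F (ω-order t a b a<b)
  }
  where open Ψ[_]≡_ ψ

-- Ψ is injective up to isomorphism

module _ {k n} {p : Fin (suc k) → ℕ} {N : LabelledRootedNebula (suc k) (suc n) p}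
         {B : Bidding (suc k) (suc n) p} where
  open Positions N
  open Bidding B

  -- `start` has type k and is the last corner of the whole tour, so it is the last of its type.
  -- Thus the bidding determines the root.
  rootLabel-last : Ψ[ N ]≡ B → ω (fromℕ k) ⟨$⟩ʳ fromℕ n ≡ rootLabel
  rootLabel-last ψ with Fin.<-cmp (ω (fromℕ k) ⟨$⟩ˡ rootLabel) (fromℕ n)
  ... | tri≈ _ eq _ = trans (cong (ω (fromℕ k) ⟨$⟩ʳ_) (sym eq)) (inverseʳ (ω (fromℕ k)))
  ... | tri> _ _ gt = contradiction gt (ℕ.≤⇒≯ (Fin.≤fromℕ _))
  ... | tri< lt _ _ = contradiction (pos≤N _) (ℕ.<⇒≱ (subst (_< pos lastExit) pos-start
    (subst (λ i → pos (half white (fromℕ k) i) < pos lastExit) (inverseʳ (ω (fromℕ k)))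
      (Ψ-increasing {N = N} ψ (fromℕ k) _ _ lt))))
    where lastExit = half white (fromℕ k) (ω (fromℕ k) ⟨$⟩ʳ fromℕ n)

  bud⇔∈ : Ψ[ N ]≡ B → ∀ c t i → Bud (half c t i) ⇔ t ∈ R i
  bud⇔∈ ψ black t i = mk⇔ (Equivalence.from (Ψ-∈⇔bud {N = N} ψ i t)) (Equivalence.to (Ψ-∈⇔bud {N = N} ψ i t))
  bud⇔∈ ψ white t i = mk⇔ (Equivalence.from (Ψ-∈⇔bud {N = N} ψ i t) ∘ bud-opposite black)
                          (bud-opposite white ∘ Equivalence.to (Ψ-∈⇔bud {N = N} ψ i t))

module Comparison {k n} {p : Fin (suc k) → ℕ} {B : Bidding (suc k) (suc n) p}
                  (N N′ : LabelledRootedNebula (suc k) (suc n) p)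
                  (ψ : Ψ[ N ]≡ B) (ψ′ : Ψ[ N′ ]≡ B) where
  private
    module N  = Positions N
    module N′ = Positions N′
  open Bidding B

  -- A relation rather than the map `φ`, so that it can be reversed and the comparison serves both
  -- directions, `F` and `G`.
  Same : N.H → N′.H → Set
  Same h h′ = N.colourOf h ≡ N′.colourOf h′ × N.type h ≡ N′.type h′ × N.label h ≡ N′.label h′

  same-half : ∀ c t i → Same (N.half c t i) (N′.half c t i)
  same-half c t i = trans (N.colour-half c t i) (sym (N′.colour-half c t i)) ,
    trans (N.type-half c t i) (sym (N′.type-half c t i)) ,
    trans (N.label-half c t i) (sym (N′.label-half c t i))

  same-functional : ∀ {h h₁ h₂} → Same h h₁ → Same h h₂ → h₁ ≡ h₂
  same-functional (c , t , l) (c′ , t′ , l′) =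
    N′.coordinates-injective (trans (sym c) c′) (trans (sym t) t′) (trans (sym l) l′)

  same-injective : ∀ {h h₁ h₂} → Same h₁ h → Same h₂ h → h₁ ≡ h₂
  same-injective (c , t , l) (c′ , t′ , l′) =
    N.coordinates-injective (trans c (sym c′)) (trans t (sym t′)) (trans l (sym l′))

  φ : N.H → N′.H
  φ h = N′.half (N.colourOf h) (N.type h) (N.label h)

  same-φ : ∀ h → Same h (φ h)
  same-φ h = subst (λ g → Same g (φ h)) (sym (N.half-unique refl refl refl)) (same-half _ _ _)

  φ-same : ∀ {h h′} → Same h h′ → φ h ≡ h′
  φ-same {h} s = same-functional (same-φ h) s

  φ-injective : Injective _≡_ _≡_ φ
  φ-injective {g} {h} eq = same-injective (same-φ g) (subst (Same h) (sym eq) (same-φ h))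

  same-mate : ∀ {h h′} → Same h h′ → Same (N.mate h) (N′.mate h′)
  same-mate {h} {h′} s with refl ← φ-same s = subst (λ g → Same (N.mate g) (N′.mate (φ h)))
    (sym (N.half-unique refl refl refl)) (of-half (N.colourOf h) (N.type h) (N.label h))
    where
    of-half : ∀ c t i → Same (N.mate (N.half c t i)) (N′.mate (N′.half c t i))
    of-half c t i with t ∈? R i
    ... | yes t∈R = subst (Same _) (sym (Equivalence.from (bud⇔∈ {N = N′} ψ′ c t i) t∈R))
      (subst (λ h → Same h _) (sym (Equivalence.from (bud⇔∈ {N = N} ψ c t i) t∈R)) (same-half c t i))
    ... | no t∉R = subst (Same _) (sym (N′.mate-half (t∉R ∘ Equivalence.to (bud⇔∈ {N = N′} ψ′ c t i))))
      (subst (λ h → Same h _) (sym (N.mate-half (t∉R ∘ Equivalence.to (bud⇔∈ {N = N} ψ c t i))))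
        (same-half (opposite c) t i))

  -- If the tours agree up to step j, the next white corner of N cannot come
  -- before that of N′ in the order of exits, since N′ would have visited it.
  not-before : ∀ j → (∀ i → i ≤ j → Same (fold N.start N.turn i) (fold N′.start N′.turn i)) →
    suc j ≤ N.#H → suc j ≤ N′.#H → ∀ u a b →
    fold N.start N.turn (suc j) ≡ N.half white u a → fold N′.start N′.turn (suc j) ≡ N′.half white u b →
    ¬ (ω u ⟨$⟩ˡ a Fin.< ω u ⟨$⟩ˡ b)
  not-before j agree j<H j<H′ u a b eq eq′ lt = contradiction
    (N.fold-injective (N′.1≤pos _) (ℕ.≤-trans i≤j (ℕ.<⇒≤ j<H)) (s≤s z≤n) j<H
      (trans (same-injective (subst (Same _) (N′.fold-pos _) (agree i i≤j)) (same-half white u a)) (sym eq)))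
    (ℕ.<⇒≢ (s≤s i≤j))
    where
    i = N′.pos (N′.half white u a)

    i≤j : i ≤ j
    i≤j = ℕ.≤-pred (subst (i <_) (trans (cong N′.pos (sym eq′)) (N′.pos-fold (s≤s z≤n) j<H′))
      (subst (λ c → N′.pos (N′.half white u c) < N′.pos (N′.half white u b)) (inverseʳ (ω u))
        (subst (λ c → N′.pos (N′.half white u (ω u ⟨$⟩ʳ (ω u ⟨$⟩ˡ a))) < N′.pos (N′.half white u c)) (inverseʳ (ω u))
          (Ψ-increasing {N = N′} ψ′ u _ _ lt))))

  vertex-label : ∀ {h v} → N.vertex h ≡ v → (b : N.Black v) → N.blackLabel v b ≡ N.label h
  vertex-label refl b = N.label-black _ b

module _ {k n} {p : Fin (suc k) → ℕ} {B : Bidding (suc k) (suc n) p}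
         (N N′ : LabelledRootedNebula (suc k) (suc n) p)
         (ψ : Ψ[ N ]≡ B) (ψ′ : Ψ[ N′ ]≡ B) where
  private
    module N  = Positions N
    module N′ = Positions N′
    module F = Comparison N N′ ψ ψ′
    module G = Comparison N′ N ψ′ ψ
    module B = Bidding B
  open F using (Same)

  same-sym : ∀ {h h′} → Same h h′ → G.Same h′ h
  same-sym (c , t , l) = sym c , sym t , sym l

  #H≡ : N.#H ≡ N′.#H
  #H≡ = ℕ.≤-antisym (injective⇒≤ F.φ-injective) (injective⇒≤ G.φ-injective)

  private
    h  = fold N.start N.turn
    h′ = fold N′.start N′.turn

    -- At a black vertex the coordinates determine the next half-edge. At a white vertex only its
    -- label is in doubt, and `not-before` in both directions gives the two candidates the same
    -- place in ω.
    same-rot : ∀ j → (∀ i → i ≤ j → Same (h i) (h′ i)) → suc j ≤ N.#H →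
      ∀ c t l → N.mate (h j) ≡ N.half c t l → N′.mate (h′ j) ≡ N′.half c t l → Same (h (suc j)) (h′ (suc j))
    same-rot j agree j<H black t l eq eq′ = subst (Same _) (sym (trans (cong N′.rot eq′) (N′.rot-black t l)))
      (subst (λ g → Same g _) (sym (trans (cong N.rot eq) (N.rot-black t l))) (F.same-half black (next t) l))
    same-rot j agree j<H white t l eq eq′ with N.rot-white t l | N′.rot-white t l
    ... | a , rot≡ | b , rot≡′ = subst (Same _) (sym after′) (subst (λ g → Same g _) (sym after)
          (subst (λ c → Same (N.half white (prev t) a) (N′.half white (prev t) c)) a≡b (F.same-half white (prev t) a)))
      where
      after = trans (cong N.rot eq) rot≡
      after′ = trans (cong N′.rot eq′) rot≡′
      j<H′ = subst (suc j ≤_) #H≡ j<H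

      a≡b : a ≡ b
      a≡b with Fin.<-cmp (B.ω (prev t) ⟨$⟩ˡ a) (B.ω (prev t) ⟨$⟩ˡ b)
      ... | tri≈ _ e _  = ⟨$⟩ʳ-injective (Perm.flip (B.ω (prev t))) e
      ... | tri< lt _ _ = contradiction lt (F.not-before j agree j<H j<H′ (prev t) a b after after′)
      ... | tri> _ _ gt = contradiction gt
        (G.not-before j (λ i i≤j → same-sym (agree i i≤j)) j<H′ j<H (prev t) b a after′ after)

    same-tour : ∀ j → j ≤ N.#H → ∀ i → i ≤ j → Same (h i) (h′ i)
    same-tour zero _ zero _ = subst (λ l → Same N.start (N′.half white (fromℕ k) l))
      (trans (sym (rootLabel-last {N = N} ψ)) (rootLabel-last {N = N′} ψ′)) (F.same-half white (fromℕ k) N.rootLabel)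
    same-tour (suc j) j<H i i≤ with ℕ.m≤n⇒m<n∨m≡n i≤
    ... | inj₁ i<j  = same-tour j (ℕ.<⇒≤ j<H) i (ℕ.≤-pred i<j)
    ... | inj₂ refl = same-rot j agree j<H _ _ _ (N.half-unique refl refl refl)
                        (N′.half-unique (sym c) (sym t) (sym l))
      where
      agree = same-tour j (ℕ.<⇒≤ j<H)
      mates = F.same-mate (agree j ℕ.≤-refl)
      c = proj₁ mates
      t = proj₁ (proj₂ mates)
      l = proj₂ (proj₂ mates)

  φ-turn : ∀ g → F.φ (N.turn g) ≡ N′.turn (F.φ g)
  φ-turn g with j , j<H , refl ← N.fold-before g =
    trans (F.φ-same (same-tour (suc j) j<H (suc j) ℕ.≤-refl))
      (cong N′.turn (sym (F.φ-same (same-tour j (ℕ.<⇒≤ j<H) j ℕ.≤-refl))))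

  φ-mate : ∀ g → F.φ (N.mate g) ≡ N′.mate (F.φ g)
  φ-mate g = F.φ-same (F.same-mate (F.same-φ g))

  -- `rot` is `turn` after `mate`, since `mate` is an involution, and `φ` commutes with both.
  φ-rot : ∀ g → F.φ (N.rot g) ≡ N′.rot (F.φ g)
  φ-rot g = trans (cong (F.φ ∘ N.rot) (sym (N.mate-involutive g)))
    (trans (φ-turn (N.mate g)) (cong N′.rot (trans (cong N′.mate (φ-mate g)) (N′.mate-involutive _))))

  φ-inverse : ∀ g → G.φ (F.φ g) ≡ g
  φ-inverse g = G.φ-same (same-sym (F.same-φ g))

  φ-vertex : ∀ g g₁ → N.vertex g ≡ N.vertex g₁ → N′.vertex (F.φ g) ≡ N′.vertex (F.φ g₁)
  φ-vertex g g₁ eq with m , refl ← Equivalence.to (N.rot-cyclic g g₁) eq =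
    Equivalence.from (N′.rot-cyclic _ _) (m , sym (fold-φ m))
    where
    fold-φ : ∀ m → F.φ (fold g N.rot m) ≡ fold (F.φ g) N′.rot m
    fold-φ zero    = refl
    fold-φ (suc m) = trans (φ-rot _) (cong N′.rot (fold-φ m))

  -- A vertex without half-edges could not be joined to the vertex of `start`. So a map on
  -- half-edges determines the map on vertices.
  halfEdge : ∀ v → ∃ λ g → N.vertex g ≡ v
  halfEdge v with N.connected v (N.vertex N.start)
  ... | ε              = N.start , refl
  ... | (g , eq , _) ◅ _ = g , eq

  onVertex : N.V → N′.V
  onVertex v = N′.vertex (F.φ (proj₁ (halfEdge v)))

  onVertex-vertex : ∀ g → onVertex (N.vertex g) ≡ N′.vertex (F.φ g)
  onVertex-vertex g = φ-vertex _ g (proj₂ (halfEdge (N.vertex g)))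

  colour-onVertex : ∀ v → N′.colour (onVertex v) ≡ N.colour v
  colour-onVertex v = trans (sym (proj₁ (F.same-φ _))) (cong N.colour (proj₂ (halfEdge v)))

  blackLabel-onVertex : ∀ v (b : N.Black v) (b′ : N′.Black (onVertex v)) →
    N′.blackLabel (onVertex v) b′ ≡ N.blackLabel v b
  blackLabel-onVertex v b b′ = trans (G.vertex-label refl b′)
    (trans (sym (proj₂ (proj₂ (F.same-φ _)))) (sym (F.vertex-label (proj₂ (halfEdge v)) b)))

Ψ-injective : {p : Fin (suc k) → ℕ} {B : Bidding (suc k) (suc n) p}
  {N N′ : LabelledRootedNebula (suc k) (suc n) p} → Ψ[ N ]≡ B → Ψ[ N′ ]≡ B → Isomorphic N N′
Ψ-injective {N = N} {N′} ψ ψ′ = record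
  { onV = permutation (onVertex N N′ ψ ψ′) (onVertex N′ N ψ′ ψ)
            (inverse N′ N ψ′ ψ) (inverse N N′ ψ ψ′)
  ; onH = permutation F.φ G.φ (φ-inverse N′ N ψ′ ψ) (φ-inverse N N′ ψ ψ′)
  ; vertex-≅ = λ h → sym (onVertex-vertex N N′ ψ ψ′ h)
  ; rot-≅ = λ h → sym (φ-rot N N′ ψ ψ′ h)
  ; mate-≅ = λ h → sym (φ-mate N N′ ψ ψ′ h)
  ; colour-≅ = colour-onVertex N N′ ψ ψ′
  ; type-≅ = λ h → sym (proj₁ (proj₂ (F.same-φ h)))
  ; root-≅ = N′.blackLabel-injective _ _ N′.root-black root-image-black (trans root-labels
      (sym (blackLabel-onVertex N N′ ψ ψ′ N.root N.root-black root-image-black)))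
  ; blackLabel-≅ = blackLabel-onVertex N N′ ψ ψ′
  ; budLabel-≅ = λ h b b′ → trans (N′.label-bud _ b′)
      (trans (sym (proj₂ (proj₂ (F.same-φ h)))) (sym (N.label-bud h b)))
  }
  where
  module N  = Positions N
  module N′ = Positions N′
  module F = Comparison N N′ ψ ψ′
  module G = Comparison N′ N ψ′ ψ

  inverse : ∀ N N′ ψ ψ′ v → onVertex N′ N ψ′ ψ (onVertex N N′ ψ ψ′ v) ≡ v
  inverse N N′ ψ ψ′ v = trans (onVertex-vertex N′ N ψ′ ψ _)
    (trans (cong (LabelledRootedNebula.vertex N) (φ-inverse N N′ ψ ψ′ _)) (proj₂ (halfEdge N N′ ψ ψ′ v)))

  root-image-black : N′.Black (onVertex N N′ ψ ψ′ N.root)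
  root-image-black = trans (colour-onVertex N N′ ψ ψ′ N.root) N.root-black

  root-labels : N′.rootLabel ≡ N.rootLabel
  root-labels = trans (sym (rootLabel-last {N = N′} ψ′)) (rootLabel-last {N = N} ψ)

-- The nebula of a valid bidding

opposite-involutive : ∀ c → opposite (opposite c) ≡ c
opposite-involutive black = refl
opposite-involutive white = refl

opposite≢ : ∀ c → opposite c ≢ c
opposite≢ black ()
opposite≢ white ()

-- By `Frame` every nebula has these coordinates, so a realisation may take them as its half-edges.
module HalfEdges (k n : ℕ) where

  private
    code : Colour → Fin 2
    code black = zero
    code white = suc zero

    decode : Fin 2 → Colour
    decode zero       = black
    decode (suc zero) = white

    decode-code : ∀ c → decode (code c) ≡ c
    decode-code black = refl
    decode-code white = refl

    code-decode : ∀ x → code (decode x) ≡ x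
    code-decode zero       = refl
    code-decode (suc zero) = refl

  opaque
    #H : ℕ
    #H = 2 * (k * n)

  H : Set
  H = Fin #H

  opaque
    unfolding #H

    half : Colour → Fin k → Fin n → H
    half c t i = combine (code c) (combine t i)

    col : H → Colour
    col h = decode (proj₁ (remQuot (k * n) h))

    typ : H → Fin k
    typ h = proj₁ (remQuot {k} n (proj₂ (remQuot {2} (k * n) h)))

    lab : H → Fin n
    lab h = proj₂ (remQuot {k} n (proj₂ (remQuot {2} (k * n) h)))

    col-half : ∀ c t i → col (half c t i) ≡ c
    col-half c t i = trans (cong (decode ∘ proj₁) (Fin.remQuot-combine (code c) (combine t i))) (decode-code c)

    typ-half : ∀ c t i → typ (half c t i) ≡ t
    typ-half c t i = trans (cong (proj₁ ∘ remQuot {k} n ∘ proj₂) (Fin.remQuot-combine (code c) (combine t i)))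
      (cong proj₁ (Fin.remQuot-combine t i))

    lab-half : ∀ c t i → lab (half c t i) ≡ i
    lab-half c t i = trans (cong (proj₂ ∘ remQuot {k} n ∘ proj₂) (Fin.remQuot-combine (code c) (combine t i)))
      (cong proj₂ (Fin.remQuot-combine t i))

    half-eta : ∀ h → half (col h) (typ h) (lab h) ≡ h
    half-eta h = trans (cong₂ combine (code-decode (proj₁ (remQuot {2} (k * n) h))) (Fin.combine-remQuot {k} n (proj₂ (remQuot {2} (k * n) h)))) (Fin.combine-remQuot {2} (k * n) h)

  half-unique : ∀ {h c t i} → col h ≡ c → typ h ≡ t → lab h ≡ i → h ≡ half c t i
  half-unique refl refl refl = sym (half-eta _)

  by-half : (P : H → Set) → (∀ c t i → P (half c t i)) → ∀ h → P h
  by-half P f h = subst P (half-eta h) (f _ _ _)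

module Digraph {k n} {p : Fin (suc k) → ℕ} (B : Bidding (suc k) (suc n) p) where
  open Bidding B public
  open HalfEdges (suc k) (suc n) public

  opaque
    mate : H → H
    mate h with typ h ∈? R (lab h)
    ... | yes _ = h
    ... | no  _ = half (opposite (col h)) (typ h) (lab h)

    mate-bud : ∀ {h} → typ h ∈ R (lab h) → mate h ≡ h
    mate-bud {h} ∈R with typ h ∈? R (lab h)
    ... | yes _ = refl
    ... | no ∉R = contradiction ∈R ∉R

    mate-edge : ∀ {h} → typ h ∉ R (lab h) → mate h ≡ half (opposite (col h)) (typ h) (lab h)
    mate-edge {h} ∉R with typ h ∈? R (lab h)
    ... | yes ∈R = contradiction ∈R ∉R
    ... | no _   = refl

  mate-half-bud : ∀ {c t i} → t ∈ R i → mate (half c t i) ≡ half c t i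
  mate-half-bud {c} {t} {i} ∈R =
    mate-bud (subst (_∈ R (lab (half c t i))) (sym (typ-half c t i)) (subst (λ j → t ∈ R j) (sym (lab-half c t i)) ∈R))

  mate-half-edge : ∀ {c t i} → t ∉ R i → mate (half c t i) ≡ half (opposite c) t i
  mate-half-edge {c} {t} {i} ∉R = trans (mate-edge (∉R ∘ subst (_∈ R i) (typ-half c t i) ∘
      subst (λ j → typ (half c t i) ∈ R j) (lab-half c t i)))
    (cong₂ (λ c f → f c) (cong opposite (col-half c t i)) (cong₂ (λ t i c → half c t i) (typ-half c t i) (lab-half c t i)))

  mate-half-involutive : ∀ c t i → mate (mate (half c t i)) ≡ half c t i
  mate-half-involutive c t i with t ∈? R i
  ... | yes ∈R = trans (cong mate (mate-half-bud ∈R)) (mate-half-bud ∈R)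
  ... | no  ∉R = trans (cong mate (mate-half-edge ∉R))
    (trans (mate-half-edge ∉R) (cong (λ c → half c t i) (opposite-involutive c)))

  mate-involutive : ∀ h → mate (mate h) ≡ h
  mate-involutive = by-half _ mate-half-involutive

  mate-fixed : ∀ {h} → mate h ≡ h → typ h ∈ R (lab h)
  mate-fixed {h} eq = decidable-stable (typ h ∈? R (lab h)) λ ∉R →
    opposite≢ (col h) (trans (sym (col-half _ _ _)) (cong col (trans (sym (mate-edge ∉R)) eq)))

  -- Any rotation which shifts the types as required shows that the digraph
  -- is balanced; this one has a white vertex for each label.
  turnType : Colour → Fin (suc k) → Fin (suc k)
  turnType black = next
  turnType white = prev

  rot₀ : H → H
  rot₀ h = half (col h) (turnType (col h) (typ h)) (lab h)

  rot₀-half : ∀ c t i → rot₀ (half c t i) ≡ half c (turnType c t) i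
  rot₀-half c t i = cong₂ (λ c f → f c) (col-half c t i)
    (cong₂ (λ t i c → half c (turnType c t) i) (typ-half c t i) (lab-half c t i))

  rot₀-injective : Injective _≡_ _≡_ rot₀
  rot₀-injective {g} {h} eq = trans (half-unique colours types labels) (half-eta h)
    where
    colours : col g ≡ col h
    colours = trans (sym (col-half _ _ _)) (trans (cong col eq) (col-half _ _ _))

    labels : lab g ≡ lab h
    labels = trans (sym (lab-half _ _ _)) (trans (cong lab eq) (lab-half _ _ _))

    turnType-injective : ∀ c {t u} → turnType c t ≡ turnType c u → t ≡ u
    turnType-injective black e = trans (sym (prev-next _)) (trans (cong prev e) (prev-next _))
    turnType-injective white e = trans (sym (next-prev _)) (trans (cong next e) (next-prev _))

    types : typ g ≡ typ h
    types = turnType-injective (col g) (trans (sym (typ-half _ _ _)) (trans (cong typ eq)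
      (trans (typ-half _ _ _) (cong (λ c → turnType c (typ h)) (sym colours)))))

  -- The half-edges are the arcs; all white half-edges of the same type
  -- leave the same vertex, and each black half-edge is alone at its vertex.
  Q : Set
  Q = Fin (suc k) ⊎ H

  tailBy : Colour → H → Q
  tailBy white h = inj₁ (typ h)
  tailBy black h = inj₂ h

  tail : H → Q
  tail h = tailBy (col h) h

  tail-white : ∀ t i → tail (half white t i) ≡ inj₁ t
  tail-white t i rewrite col-half white t i = cong inj₁ (typ-half white t i)

  tail-black : ∀ t i → tail (half black t i) ≡ inj₂ (half black t i)
  tail-black t i rewrite col-half black t i = refl

  tail≡inj₁ : ∀ {h t} → tail h ≡ inj₁ t → col h ≡ white × typ h ≡ t
  tail≡inj₁ {h} eq with col h
  tail≡inj₁ refl | white = refl , refl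

  tail≡inj₂ : ∀ {h g} → tail h ≡ inj₂ g → h ≡ g
  tail≡inj₂ {h} eq with col h
  tail≡inj₂ refl | black = refl

  rank : H → ℕ
  rank h = toℕ (ω (typ h) ⟨$⟩ˡ lab h)

  rank-white : ∀ t i → rank (half white t (ω t ⟨$⟩ʳ i)) ≡ toℕ i
  rank-white t i rewrite typ-half white t (ω t ⟨$⟩ʳ i) | lab-half white t (ω t ⟨$⟩ʳ i) = cong toℕ (inverseˡ (ω t))

  lastExit : Fin (suc k) → H
  lastExit t = half white t (ω t ⟨$⟩ʳ fromℕ n)

  rank≤ : ∀ h t → rank h ≤ rank (lastExit t)
  rank≤ h t = subst (rank h ≤_) (sym (rank-white t (fromℕ n))) (Fin.≤fromℕ _)

  τ : Permutation′ #H
  τ = injective⇒permutation (rot₀ ∘ mate)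
    (λ {g} {h} eq → trans (sym (mate-involutive g)) (trans (cong mate (rot₀-injective eq)) (mate-involutive h)))
    ℕ.≤-refl

  _≟Q_ : DecidableEquality Q
  _≟Q_ = Sum.≡-dec _≟_ _≟_

  open Tour _≟Q_ tail τ rank (lastExit (fromℕ k)) (λ h _ → rank≤ h (fromℕ k)) public

  parent : Fin (suc k) → Fin (suc k)
  parent t = α t (R (ω t ⟨$⟩ʳ fromℕ n))

  head-bud : ∀ {c t i} → t ∈ R i → head (half c t i) ≡ tail (half c (turnType c t) i)
  head-bud ∈R = cong tail (trans (cong rot₀ (mate-half-bud ∈R)) (rot₀-half _ _ _))

  head-edge : ∀ {c t i} → t ∉ R i → head (half c t i) ≡ tail (half (opposite c) (turnType (opposite c) t) i)
  head-edge ∉R = cong tail (trans (cong rot₀ (mate-half-edge ∉R)) (rot₀-half _ _ _))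

  module _ {m} (T : Trail m) (stuck : Stuck T) (tree : IsTree (ParentGraph.graph parent)) where
    open Trail T using (Used)

    private
      module G = ParentGraph parent

      WhitesUsed : Fin (suc k) → Set
      WhitesUsed t = ∀ i → Used (half white t i)

      exits-white : ∀ {t i} → WhitesUsed t → ∀ a → tail a ≡ tail (half white t i) → Used a
      exits-white {t} {i} used a eq = subst Used (sym (half-unique (proj₁ whites) (proj₂ whites) refl)) (used (lab a))
        where whites = tail≡inj₁ (trans eq (tail-white t i))

      exits-black : ∀ {t i} → Used (half black t i) → ∀ a → tail a ≡ tail (half black t i) → Used a
      exits-black {t} {i} used a eq = subst Used (sym (tail≡inj₂ (trans eq (tail-black t i)))) used

      -- No exit from `t` ranks above the last one, so `propagate` at `lastExit t` reaches all of
      -- them.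
      whites : ∀ t → (∀ a → tail a ≡ head (lastExit t) → Used a) → WhitesUsed t
      whites t exits i = propagate T stuck (lastExit t) exits (half white t i)
        (trans (tail-white t i) (sym (tail-white t _))) (sameOrLess (ℕ.m≤n⇒m<n∨m≡n (rank≤ (half white t i) t)))
        where
        sameOrLess : rank (half white t i) < rank (lastExit t) ⊎ rank (half white t i) ≡ rank (lastExit t) →
          half white t i ≡ lastExit t ⊎ rank (half white t i) < rank (lastExit t)
        sameOrLess (inj₁ lt) = inj₂ lt
        sameOrLess (inj₂ eq) = inj₁ (cong (half white t) (trans (sym (inverseʳ (ω t)))
          (cong (ω t ⟨$⟩ʳ_) (toℕ-injective (trans (sym (rank-white t _))
            (trans (cong (rank ∘ half white t) (inverseʳ (ω t))) (trans eq (rank-white t _))))))))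

      black-bud : ∀ {t i} → t ∈ R i → Used (half black (next t) i) → Used (half black t i)
      black-bud {t} {i} ∈R used = propagate T stuck (half black t i)
        (λ a eq → exits-black used a (trans eq (head-bud ∈R))) _ refl (inj₁ refl)

      black-edge : ∀ {t i} → t ∉ R i → WhitesUsed (prev t) → Used (half black t i)
      black-edge {t} {i} ∉R used = propagate T stuck (half black t i)
        (λ a eq → exits-white used a (trans eq (head-edge ∉R))) _ refl (inj₁ refl)

      black-run : ∀ t i r → (∀ j → 1 ≤ j → j ≤ r → fold t next j ∈ R i) →
        Used (half black (fold t next (suc r)) i) → Used (half black (next t) i)
      black-run t i zero    _   used = used
      black-run t i (suc r) all used = black-run t i r (λ j 1≤j j≤r → all j 1≤j (ℕ.m≤n⇒m≤1+n j≤r))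
        (black-bud (all (suc r) (s≤s z≤n) ℕ.≤-refl) used)

      -- The arc from `t` to `parent t` stands for a path which may run through black half-edges.
      -- Each of these is the only exit from its vertex, so being used travels back along the path
      -- to the last exit from `t`.
      from-parent : ∀ t → WhitesUsed (parent t) → WhitesUsed t
      from-parent t used = by-cases (t ∈? R i)
        where
        i = ω t ⟨$⟩ʳ fromℕ n

        by-cases : Dec (t ∈ R i) → WhitesUsed t
        by-cases (yes ∈R) = whites t λ a eq →
          exits-white (subst WhitesUsed (α-∈ ∈R) used) a (trans eq (head-bud ∈R))
        by-cases (no ∉R) with r , all , ∉R′ , α≡ ← α-∉ t (R i) ∉R = whites t λ a eq →
          exits-black (black-run t i r all (black-edge ∉R′
            (subst WhitesUsed (trans α≡ (sym (prev-next _))) used))) a (trans eq (head-edge ∉R))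

      all-whites : ∀ {t} → G.Descendant t → WhitesUsed t
      -- The trail ends where it began, at type k, and is stuck there, so all exits from the root of
      -- the tree are used.
      all-whites G.ancestor i = stuck _ (trans (tail-white _ i) (trans (sym (tail-white _ _)) (sym (closed T stuck))))
      all-whites (G.below s d) = from-parent (G.child s) (all-whites d)

      whites-used : ∀ t → WhitesUsed t
      whites-used t = all-whites (G.tree⇒descendant tree t)

      -- Buds are followed upwards in type until one meets an edge, whose mate leads to exits
      -- already known to be used; `r` bounds this search, and `R-strict` provides the edge.
      blacks-used : ∀ i r t → fold t next r ∉ R i → Used (half black t i)
      blacks-used i r t ∉R = by-cases r ∉R (t ∈? R i)
        where
        by-cases : ∀ r → fold t next r ∉ R i → Dec (t ∈ R i) → Used (half black t i)
        by-cases r       _  (no t∉R)  = black-edge t∉R (whites-used (prev t))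
        by-cases zero    ∉R (yes t∈R) = contradiction t∈R ∉R
        by-cases (suc r) ∉R (yes t∈R) =
          black-bud t∈R (blacks-used i r (next t) (∉R ∘ subst (_∈ R i) (fold-commute t next r)))

    all-used : ∀ h → Used h
    all-used = by-half Used λ
      { black t i → let _ , u , _ , u∉R = R-strict i
                        r , eq = next-transitive t u
                    in blacks-used i r t (subst (_∉ R i) (sym eq) u∉R)
      ; white t i → whites-used t i }

-- From an Eulerian tour to a rotation system

module FromTour {k n} {p : Fin (suc k) → ℕ} (B : Bidding (suc k) (suc n) p) where
  open Digraph B

  module _ (walk : H → H) (walk-linked : ∀ h → tail (walk h) ≡ head h)
           (walk-transitive : ∀ g h → ∃ λ m → fold g walk m ≡ h)
           (walk-order : ∀ g h → tail g ≡ tail h → rank g < rank h →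
             ∃₂ λ i j → 1 ≤ i × i < j × j ≤ #H ×
               fold (lastExit (fromℕ k)) walk i ≡ g × fold (lastExit (fromℕ k)) walk j ≡ h) where

    private
      walk-injective : Injective _≡_ _≡_ walk
      walk-injective = surjective⇒injective ℕ.≤-refl λ h →
        let m , eq = walk-transitive (walk h) h in fold h walk m , trans (sym (fold-commute h walk m)) eq

      -- Chosen so that `turn` becomes `walk`; transitivity of the tour then says that there is a
      -- single face.
      rotation : Permutation′ #H
      rotation = injective⇒permutation (walk ∘ mate)
        (λ {g} {h} eq → trans (sym (mate-involutive g)) (trans (cong mate (walk-injective eq)) (mate-involutive h)))
        ℕ.≤-refl

      rot : H → H
      rot = rotation ⟨$⟩ʳ_

      -- Tails carry the type of a white half-edge and the identity of a black one. As `walk` agrees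
      -- with τ on tails, the type conditions are inherited from `rot₀`.
      tail-rot : ∀ h → tail (rot h) ≡ tail (rot₀ h)
      tail-rot h = trans (walk-linked (mate h)) (cong (tail ∘ rot₀) (mate-involutive h))

      rot-black : ∀ t i → rot (half black t i) ≡ half black (next t) i
      rot-black t i = tail≡inj₂ (trans (tail-rot _) (trans (cong tail (rot₀-half black t i)) (tail-black (next t) i)))

      rot-white : ∀ t i → col (rot (half white t i)) ≡ white × typ (rot (half white t i)) ≡ prev t
      rot-white t i = tail≡inj₁ (trans (tail-rot _) (trans (cong tail (rot₀-half white t i)) (tail-white (prev t) i)))

      col-rot : ∀ h → col (rot h) ≡ col h
      col-rot = by-half _ λ
        { black t i → trans (cong col (rot-black t i)) (trans (col-half black (next t) i) (sym (col-half black t i)))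
        ; white t i → trans (proj₁ (rot-white t i)) (sym (col-half white t i)) }

      black-rot : ∀ h → col h ≡ black → lab (rot h) ≡ lab h × typ (rot h) ≡ next (typ h)
      black-rot = by-half _ λ
        { black t i _ → trans (cong lab (rot-black t i)) (trans (lab-half black (next t) i) (sym (lab-half black t i))) ,
            trans (cong typ (rot-black t i)) (trans (typ-half black (next t) i) (cong next (sym (typ-half black t i))))
        ; white t i b → contradiction b (white≢black (col-half white t i)) }

      white-rot : ∀ h → col h ≡ white → typ (rot h) ≡ prev (typ h)
      white-rot = by-half _ λ
        { black t i w → contradiction (col-half black t i) (white≢black w)
        ; white t i _ → trans (proj₂ (rot-white t i)) (cong prev (sym (typ-half white t i))) }

      open Orbits rotation using (_~_; orbits)
      open Quotient orbits using (#classes; class; repr; class-repr; effective; sound)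

      col-orbit : ∀ g m → col (fold g rot m) ≡ col g
      col-orbit g zero    = refl
      col-orbit g (suc m) = trans (col-rot _) (col-orbit g m)

      lab-orbit : ∀ g → col g ≡ black → ∀ m → lab (fold g rot m) ≡ lab g
      lab-orbit g b zero    = refl
      lab-orbit g b (suc m) = trans (proj₁ (black-rot _ (trans (col-orbit g m) b))) (lab-orbit g b m)

      colour : Fin #classes → Colour
      colour v = col (repr v)

      repr-class : ∀ h → repr (class h) ~ h
      repr-class h = effective (class-repr (class h))

      colour-class : ∀ h → colour (class h) ≡ col h
      colour-class h = let m , eq = repr-class h in trans (sym (col-orbit _ m)) (cong col eq)

      label-class : ∀ h → col h ≡ black → lab (repr (class h)) ≡ lab h
      label-class h b = let m , eq = repr-class h in
        trans (sym (lab-orbit _ (trans (colour-class h) b) m)) (cong lab eq)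

      class-black : ∀ t u i → class (half black t i) ≡ class (half black u i)
      class-black t u i = let m , eq = next-transitive t u in
        sound (m , trans (fold-black m) (cong (λ u → half black u i) eq))
        where
        fold-black : ∀ m → fold (half black t i) rot m ≡ half black (fold t next m) i
        fold-black zero    = refl
        fold-black (suc m) = trans (cong rot (fold-black m)) (rot-black _ i)

      black-class : ∀ v → colour v ≡ black → ∀ t → class (half black t (lab (repr v))) ≡ v
      black-class v b t = trans (class-black t (typ (repr v)) _)
        (trans (cong class (sym (half-unique b refl refl))) (class-repr v))

      turn-walk : ∀ h → rot (mate h) ≡ walk h
      turn-walk h = cong walk (mate-involutive h)

      fold-turn : ∀ g m → fold g (rot ∘ mate) m ≡ fold g walk m
      fold-turn g zero    = refl
      fold-turn g (suc m) = trans (turn-walk _) (cong walk (fold-turn g m))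

      Adj : Fin #classes → Fin #classes → Set
      Adj u v = ∃ λ h → class h ≡ u × class (mate h) ≡ v

      -- Each step of the tour leads to the vertex at the other end of the half-edge, so the tour
      -- itself connects the vertices.
      path : ∀ g m → Star Adj (class g) (class (fold g walk m))
      path g zero    = ε
      path g (suc m) = path g m ◅◅ ((fold g walk m , refl , sound (1 , turn-walk _)) ◅ ε)

      map : Map
      map = record
        { #V = #classes
        ; #H = #H
        ; vertex = class
        ; rotation = rotation
        ; mate = mate
        ; rot-cyclic = λ g h → mk⇔ effective sound
        ; mate-involutive = mate-involutive
        ; connected = λ u v → let m , eq = walk-transitive (repr u) (repr v) in
            subst (λ u → Star Adj u v) (class-repr u) (subst (Star Adj (class (repr u)))
              (trans (cong class eq) (class-repr v)) (path (repr u) m))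
        }

      -- Whether a half-edge is a bud depends on its type and label alone, so both colours give the
      -- same count; this yields the balance.
      buds : ∀ c t → count (λ h → ((mate h ≟ h) ×-dec (colour (class h) ≟ᶜ c)) ×-dec (typ h ≟ t)) ≡ p t
      buds c t = trans (count-≡ _ (λ i → t ∈? R i) lab (half c t)
        (λ { h ((m , _) , refl) → mate-fixed m })
        (λ i ∈R → (mate-half-bud ∈R , trans (colour-class _) (col-half c t i)) , typ-half c t i)
        (λ h ((_ , cc) , tt) → sym (half-unique (trans (sym (colour-class h)) cc) tt refl))
        (λ i _ → lab-half c t i)) (R-type t)

      nebula : Nebula (suc k)
      nebula = record
        { map = map
        ; colour = colour
        ; type = typ
        ; type-mate = by-half _ λ c t i → trans (typ-mate c t i) (sym (typ-half c t i))
        ; single-face = λ g h → let m , eq = walk-transitive g h in m , trans (fold-turn g m) eq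
        ; bipartite = λ h ¬bud eq → opposite≢ (col h) (trans (sym (col-half _ _ _))
            (trans (cong col (sym (mate-edge (¬bud ∘ mate-bud)))) (trans (sym (colour-class _)) (trans eq (colour-class h)))))
        ; black-degree = λ v b → trans (count-≡ (λ h → class h ≟ v) U? typ (λ t → half black t (lab (repr v)))
            (λ _ _ → _) (λ t _ → black-class v b t)
            (λ { h refl → sym (half-unique (trans (sym (colour-class h)) b) refl
                            (sym (label-class h (trans (sym (colour-class h)) b)))) })
            (λ t _ → typ-half black t _)) (count-U (suc k))
        ; black-types = λ h b → proj₂ (black-rot h (trans (sym (colour-class h)) b))
        ; white-types = λ h w → white-rot h (trans (sym (colour-class h)) w)
        ; balanced = λ t → trans (buds black t) (sym (buds white t))
        }
        where
        typ-mate : ∀ c t i → typ (mate (half c t i)) ≡ t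
        typ-mate c t i with t ∈? R i
        ... | yes ∈R = trans (cong typ (mate-half-bud ∈R)) (typ-half c t i)
        ... | no  ∉R = trans (cong typ (mate-half-edge ∉R)) (typ-half (opposite c) t i)

      -- The only possible choice, by `rootLabel-last`.
      rootLabel : Fin (suc n)
      rootLabel = ω (fromℕ k) ⟨$⟩ʳ fromℕ n

    realisation : LabelledRootedNebula (suc k) (suc n) p
    realisation = record
      { nebula = nebula
      ; size = trans (count-≡ (λ v → colour v ≟ᶜ black) U? (λ v → lab (repr v)) (λ i → class (half black zero i))
          (λ _ _ → _) (λ i _ → trans (colour-class _) (col-half black zero i))
          (λ v b → black-class v b zero)
          (λ i _ → trans (label-class _ (col-half black zero i)) (lab-half black zero i))) (count-U (suc n))
      ; bud-type = buds black
      -- All black half-edges with this label lie in one orbit, so the type `zero` is an arbitrary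
      -- choice.
      ; root = class (half black zero rootLabel)
      ; root-black = trans (colour-class _) (col-half black zero rootLabel)
      ; blackLabel = λ v _ → lab (repr v)
      ; budLabel = λ h _ → lab h
      ; blackLabel-injective = λ u v b c eq →
          trans (sym (black-class u b zero)) (trans (cong (class ∘ half black zero) eq) (black-class v c zero))
      ; budLabel-injective = λ g h (_ , w) (_ , w′) tt ll →
          trans (half-unique (trans (sym (colour-class g)) (trans w (trans (sym w′) (colour-class h)))) tt ll) (half-eta h)
      ; budLabel-matched = λ h (m , _) → half black (typ h) (lab h) ,
          (mate-half-bud (mate-fixed m) , trans (colour-class _) (col-half black _ _)) ,
          typ-half black _ _ , trans (label-class _ (col-half black _ _)) (lab-half black _ _)
      }

    private
      module N = LabelledRootedNebula realisation

      object : ∀ t i → N.Object t i (half white t i)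
      object t i with t ∈? R i
      ... | yes ∈R = N.bud (mate-half-bud ∈R , trans (colour-class _) (col-half white t i)) (typ-half white t i) (lab-half white t i)
      ... | no ∉R = N.edge (trans (colour-class _) (col-half white t i))
        (trans (cong (colour ∘ class) (mate-half-edge ∉R)) (trans (colour-class _) (col-half black t i)))
        (typ-half white t i)
        (trans (cong (lab ∘ repr ∘ class) (mate-half-edge ∉R))
          (trans (label-class _ (col-half black t i)) (lab-half black t i)))

    Ψ-realisation : Ψ[ realisation ]≡ B
    Ψ-realisation = record
      { R-types = λ i t → mk⇔
          (λ ∈R → half black t i , (mate-half-bud ∈R , trans (colour-class _) (col-half black t i)) ,
            typ-half black t i , trans (label-class _ (col-half black t i)) (lab-half black t i))
          (λ { (h , (m , b) , refl , refl) → subst (λ i → typ h ∈ R i)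
                 (sym (label-class h (trans (sym (colour-class h)) b))) (mate-fixed m) })
      ; ω-order = λ t a b a<b →
          let i , j , 1≤i , i<j , j≤ , ei , ej = walk-order (half white t (ω t ⟨$⟩ʳ a)) (half white t (ω t ⟨$⟩ʳ b))
                (trans (tail-white t _) (sym (tail-white t _)))
                (subst (_< rank (half white t (ω t ⟨$⟩ʳ b))) (sym (rank-white t a))
                  (subst (toℕ a <_) (sym (rank-white t b)) a<b))
          in lastExit (fromℕ k) ,
             subst (λ i → N.Object (fromℕ k) i (lastExit (fromℕ k)))
               (sym (trans (label-class _ (col-half black zero rootLabel)) (lab-half black zero rootLabel)))
               (object (fromℕ k) rootLabel) ,
             i , j , 1≤i , i<j , j≤ ,
             subst (N.Object t _) (sym (trans (fold-turn _ i) ei)) (object t _) ,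
             subst (N.Object t _) (sym (trans (fold-turn _ j) ej)) (object t _)
      }

Ψ-surjective : {p : Fin (suc k) → ℕ} (B : Bidding (suc k) (suc n) p) → Valid B →
  ∃ λ (N : LabelledRootedNebula (suc k) (suc n) p) → Ψ[ N ]≡ B
Ψ-surjective B tree = realisation walk linked transitive order , Ψ-realisation walk linked transitive order
  where
  open FromTour B
  open Digraph B
  T = proj₁ (proj₂ maximal)
  stuck = proj₂ (proj₂ maximal)
  all = all-used T stuck tree
  walk = turnBy T stuck all
  linked = turnBy-linked T stuck all
  transitive = turnBy-transitive T stuck all
  order = turnBy-order T stuck all

theorem6p2 : (k n : ℕ) .{{_ : NonZero k}} .{{_ : NonZero n}} → 2 ≤ k →
    (p : Fin k → ℕ) → (∀ t → 1 ≤ p t) →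
    Σ (Bijection (LabelledRootedNebulas k n p) (ValidBiddings k n p)) λ Ψ →
    (N : LabelledRootedNebula k n p) (B : Bidding k n p) →
    (Ψ[ N ]≡ B) ⇔ (Setoid._≈_ (Biddings k n p) B (proj₁ (Bijection.to Ψ N)))
theorem6p2 (suc k) (suc n) _ p p-positive = record
  { to = λ N → image N , Ψ-valid (Ψ-image N)
  ; cong = λ {N} {N′} F → Ψ-unique (Ψ-resp-≅ F (Ψ-image N)) (Ψ-image N′)
  ; bijective =
      (λ {N} {N′} eq → Ψ-injective (Ψ-image N) (Ψ-resp-≈ (Setoid.sym Bs {image N} {image N′} eq) (Ψ-image N′))) ,
      (λ (B , valid) → let N , ψ = Ψ-surjective B valid in
        N , λ {N′} F → Ψ-unique (Ψ-image N′) (Ψ-resp-≅ (Isomorphic-sym F) ψ))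
  } , λ N B → mk⇔ (λ ψ → Ψ-unique ψ (Ψ-image N)) (λ eq → Ψ-resp-≈ (Setoid.sym Bs {B} {image N} eq) (Ψ-image N))
  where
  Bs = Biddings (suc k) (suc n) p

  image : LabelledRootedNebula (suc k) (suc n) p → Bidding (suc k) (suc n) p
  image N = Positions.Image.bidding N p-positive

  Ψ-image : ∀ N → Ψ[ N ]≡ image N
  Ψ-image N = Positions.Image.Ψ-bidding N p-positive
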